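{- Up to isomorphism, the connected $6$-regular strongly regular signed graphs that are $0$ net-regular (every vertex is incident with exactly $3$ positive and $3$ negative edges) are precisely $\dot{S}^4_8$, $-\dot{S}^4_8$, $\dot{S}_{16}$ and $-\dot{S}_{16}$, where these are defined as follows. - $\dot{S}^4_8$, with parameters $(8,6,4,-4,-6)$. The vertices are $x_1,\dots,x_4,y_1,\dots,y_4$. The edges $x_ix_j$ and $y_iy_j$ ($i\ne j$) are positive, so the positive edges form two disjoint copies of $K_4$. The edges $x_iy_j$ with $i\ne j$ are negative. The pairs $x_i,y_i$ are non-adjacent. - $\dot{S}_{16}$, with parameters $(16,6,2,2,-2)$. The vertices are $(i,j)$ with $i,j\in\{1,2,3,4\}$. The vertex $(i,j)$ is joined to $(i,j')$ by a positive edge for $j'\neq j$, and to $(i',j)$ by a negative edge for $i'\ne i$. There are no other edges, so the underlying graph is $K_4\,\square\,K_4$.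
   Context: Signed graphs. - A signed graph $\dot G=(G,\sigma)$ is a simple graph $G$ (the underlying graph) together with a sign function $\sigma:E(G)\to\{+1,-1\}$. - Its adjacency matrix $A(\dot G)$ has $(i,j)$-entry $\sigma(v_iv_j)$ if $v_i\sim v_j$ and $0$ otherwise. - Connectedness, completeness and $r$-regularity of $\dot G$ refer to $G$. - The net-degree of a vertex $v$ is $d^+(v)-d^-(v)$, where $d^{\pm}(v)$ are the numbers of positive and negative edges at $v$. $\dot G$ is $\rho$ net-regular if every vertex has net-degree $\rho$. - $\dot G$ is homogeneous if all its edges have the same sign. - The negation $-\dot G$ is obtained by reversing the sign of every edge. - Two signed graphs are isomorphic if there is an isomorphism of the underlying graphs preserving edge signs. Strongly regular signed graphs. - A signed graph $\dot G$ on $n$ vertices is a strongly regular signed graph (SRSG) if it is neither homogeneous complete nor edgeless, and there exist $r\in\mathbb N$ and $a,b,c\in\mathbb Z$ such that the $(i,j)$-entry of $A(\dot G)^2$ equals: - $r$ if $v_i=v_j$; - $a$ if $v_i$ and $v_j$ are joined by a positive edge; - $b$ if $v_i$ and $v_j$ are joined by a negative edge; - $c$ if $v_i\neq v_j$ are non-adjacent. - $(n,r,a,b,c)$ are called its parameters. -}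

module Defs where

open import Data.Nat using (ℕ; zero; suc)
open import Data.Integer using (ℤ; +_; -_; _+_; _*_; _-_)
open import Data.Fin using (Fin; zero; suc; remQuot; _≟_)
open import Data.Product using (Σ; _×_; _,_; ∃)
open import Data.Sum using (_⊎_)
open import Data.Bool using (Bool; true; false; if_then_else_; _∧_; not)
open import Relation.Nullary using (¬_; does)
open import Relation.Binary.PropositionalEquality using (_≡_; _≢_)
open import Function.Bundles using (_↔_; Inverse)

data Label : Set where
  none pos neg : Label

-- A signed graph on vertex set Fin n is given by a labelling of pairs
-- which is symmetric and irreflexive (simple underlying graph G,
-- sign function σ on E(G)).
record IsSignedGraph {n : ℕ} (L : Fin n → Fin n → Label) : Set where
  field
    symmetric   : ∀ u v → L u v ≡ L v u
    irreflexive : ∀ u → L u u ≡ none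

Σℤ : {n : ℕ} → (Fin n → ℤ) → ℤ
Σℤ {zero}  f = + 0
Σℤ {suc n} f = f zero + Σℤ (λ i → f (suc i))

adjEntry : Label → ℤ
adjEntry none = + 0
adjEntry pos  = + 1
adjEntry neg  = - (+ 1)

A : {n : ℕ} → (Fin n → Fin n → Label) → Fin n → Fin n → ℤ
A L i j = adjEntry (L i j)

A² : {n : ℕ} → (Fin n → Fin n → Label) → Fin n → Fin n → ℤ
A² L i j = Σℤ (λ k → A L i k * A L k j)

count : {n : ℕ} → (Fin n → Bool) → ℕ
count {zero}  p = 0
count {suc n} p = (if p zero then 1 else 0) Data.Nat.+ count (λ i → p (suc i))

isPos isNeg isEdge : Label → Bool
isPos pos = true
isPos _   = false
isNeg neg = true
isNeg _   = false
isEdge none = false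
isEdge _    = true

degree d⁺ d⁻ : {n : ℕ} → (Fin n → Fin n → Label) → Fin n → ℕ
degree L v = count (λ u → isEdge (L v u))
d⁺ L v = count (λ u → isPos (L v u))
d⁻ L v = count (λ u → isNeg (L v u))

netDegree : {n : ℕ} → (Fin n → Fin n → Label) → Fin n → ℤ
netDegree L v = + d⁺ L v - + d⁻ L v

Regular : {n : ℕ} → ℕ → (Fin n → Fin n → Label) → Set
Regular r L = ∀ v → degree L v ≡ r

NetRegular : {n : ℕ} → ℤ → (Fin n → Fin n → Label) → Set
NetRegular ρ L = ∀ v → netDegree L v ≡ ρ

data Walk {n : ℕ} (L : Fin n → Fin n → Label) : Fin n → Fin n → Set where
  here : ∀ {u} → Walk L u u
  step : ∀ {u v w} → L u v ≢ none → Walk L v w → Walk L u w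

Connected : {n : ℕ} → (Fin n → Fin n → Label) → Set
Connected L = ∀ u v → Walk L u v

Complete : {n : ℕ} → (Fin n → Fin n → Label) → Set
Complete L = ∀ u v → u ≢ v → L u v ≢ none

Edgeless : {n : ℕ} → (Fin n → Fin n → Label) → Set
Edgeless L = ∀ u v → L u v ≡ none

Homogeneous : {n : ℕ} → (Fin n → Fin n → Label) → Set
Homogeneous L = (∀ u v → L u v ≢ neg) ⊎ (∀ u v → L u v ≢ pos)

IsSRSGWith : {n : ℕ} → (Fin n → Fin n → Label) → ℕ → ℤ → ℤ → ℤ → Set
IsSRSGWith L r a b c =
  ¬ (Homogeneous L × Complete L) × ¬ Edgeless L ×
  (∀ i j → i ≡ j → A² L i j ≡ + r) ×
  (∀ i j → L i j ≡ pos → A² L i j ≡ a) ×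
  (∀ i j → L i j ≡ neg → A² L i j ≡ b) ×
  (∀ i j → i ≢ j → L i j ≡ none → A² L i j ≡ c)

IsSRSG : {n : ℕ} → (Fin n → Fin n → Label) → Set
IsSRSG L = Σ ℕ λ r → Σ ℤ λ a → Σ ℤ λ b → Σ ℤ λ c → IsSRSGWith L r a b c

negLabel : Label → Label
negLabel none = none
negLabel pos  = neg
negLabel neg  = pos

negate : {n : ℕ} → (Fin n → Fin n → Label) → Fin n → Fin n → Label
negate L u v = negLabel (L u v)

_≅_ : {n m : ℕ} → (Fin n → Fin n → Label) → (Fin m → Fin m → Label) → Set
_≅_ {n} {m} L M = Σ (Fin n ↔ Fin m) λ f →
  ∀ u v → M (Inverse.to f u) (Inverse.to f v) ≡ L u v

private
  eqb : {k : ℕ} → Fin k → Fin k → Bool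
  eqb i j = does (i ≟ j)

-- Ṡ⁴₈: vertex 4q + r (q ∈ Fin 2, r ∈ Fin 4) is x_{r+1} if q = 0, y_{r+1} if q = 1.
S48-lab : (Fin 2 × Fin 4) → (Fin 2 × Fin 4) → Label
S48-lab (s , i) (t , j) =
  if eqb i j then none else (if eqb s t then pos else neg)

S48 : Fin 8 → Fin 8 → Label
S48 u v = S48-lab (remQuot 4 u) (remQuot 4 v)

-- Ṡ₁₆: vertex 4i + j is the pair (i, j), i, j ∈ Fin 4.
S16-lab : (Fin 4 × Fin 4) → (Fin 4 × Fin 4) → Label
S16-lab (i , j) (i' , j') =
  if eqb i i' ∧ not (eqb j j') then pos
  else (if eqb j j' ∧ not (eqb i i') then neg else none)

S16 : Fin 16 → Fin 16 → Label
S16 u v = S16-lab (remQuot 4 u) (remQuot 4 v)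

{-# OPTIONS --safe #-}
module Submission where

-- Let P, N be the positive and negative adjacency matrices, so A = P - N, and let P(v), N(v)
-- be the three positive and three negative neighbours of v.  Away from the diagonal A² is
-- constant on positive, negative and non-adjacent pairs, so (a + b - 2c)(P + N) is a
-- combination of A², A, I and J.  If a + b = 2c, counting along a row of A² gives
-- c(n - 1) = -6, which together with 2 ∣ n and n ≥ 7 is impossible.  Hence P + N commutes
-- with A, that is, PN = NP: every positive-negative walk of length two can be replaced by
-- a negative-positive one with the same ends.
--
-- With this relation, a finite search over the fifteen labels inside P(v) ∪ N(v) shows that
-- all labels in P(v) are equal to some X, all labels in N(v) are equal to some Y, and that
-- (a, b) determines X and Y.  Eight pairs (X, Y) survive.  Two of them contradict the
-- uniformity of X and Y over all vertices, three contradict the count of the walks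
-- from v to its n - 7 non-neighbours.  For X = +, Y = - the relations "equal or positively
-- adjacent" and "equal or negatively adjacent" are commuting equivalence relations and
-- give the grid Ṡ₁₆; for X = Y = + the relations "equal or positively adjacent" and "equal or
-- non-adjacent" do and give Ṡ₈⁴.  The case X = Y = - is the negation of X = Y = +.

open import Defs
open import Data.Nat as ℕ using (ℕ; zero; suc)
import Data.Nat.Properties as ℕ
open import Data.Nat.Divisibility using (_∣_; _∣?_; divides; ∣m+n∣m⇒∣n; ∣⇒≤; ∣-trans)
open import Data.Integer using (ℤ; +_; _+_; _*_; _-_; -_; _≤_; ∣_∣)
import Data.Integer as ℤ
import Data.Integer.Properties as ℤ
open import Data.Integer.Tactic.RingSolver using (solve-∀)
open import Algebra.Properties.CommutativeMonoid.Sum ℤ.+-0-commutativeMonoid using (sum; sum-permute)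
open import Data.Fin using (Fin; zero; suc; _≟_; toℕ; fromℕ<; combine; remQuot; #_)
open import Data.Fin.Properties using (suc-injective; any?; all?; toℕ-fromℕ<; remQuot-combine; combine-remQuot)
open import Data.Bool using (Bool; true; false; if_then_else_; _∧_; not)
open import Data.Empty using (⊥; ⊥-elim)
open import Data.Product using (_×_; _,_; ∃; ∃₂; proj₁; proj₂)
open import Data.Product.Properties using (≡-dec)
open import Data.Sum using (_⊎_; inj₁; inj₂; [_,_]′)
import Data.Sum as Sum
open import Data.List using (List; []; _∷_)
open import Data.List.Membership.Propositional using (_∈_)
open import Data.List.Relation.Unary.Any using (here; there)
import Data.List.Relation.Unary.Any as Any
import Data.List.Relation.Unary.All as All
open import Function using (_∘_; id)
open import Function.Bundles using (_⇔_; _↔_; Inverse; mk⇔; mk↔ₛ′)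
open import Relation.Nullary using (Dec; yes; no; does; ¬_; contradiction)
open import Relation.Nullary.Decidable using (toWitness; from-no; map′; ¬?; decidable-stable; _×-dec_; _⊎-dec_; _→-dec_)
open import Relation.Binary using (IsEquivalence; DecidableEquality)
open import Relation.Binary.PropositionalEquality

-- Labels, profiles and the finite search around a vertex.

𝟙 : Bool → ℤ
𝟙 b = if b then + 1 else + 0

_≟ˡ_ : DecidableEquality Label
none ≟ˡ none = yes refl
none ≟ˡ pos  = no λ ()
none ≟ˡ neg  = no λ ()
pos  ≟ˡ none = no λ ()
pos  ≟ˡ pos  = yes refl
pos  ≟ˡ neg  = no λ ()
neg  ≟ˡ none = no λ ()
neg  ≟ˡ pos  = no λ ()
neg  ≟ˡ neg  = yes refl

∀Label? : {P : Label → Set} → (∀ l → Dec (P l)) → Dec (∀ l → P l)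
∀Label? P? =
  map′ (λ { (h₀ , h₊ , h₋) → λ { none → h₀ ; pos → h₊ ; neg → h₋ } })
       (λ h → h none , h pos , h neg)
       (P? none ×-dec P? pos ×-dec P? neg)

-- The labels of a vertex x towards P(v) (left) and towards N(v) (right).
record Profile : Set where
  constructor ⟨_,_,_∣_,_,_⟩
  field p₀ p₁ p₂ n₀ n₁ n₂ : Label

𝟙⁺ 𝟙⁻ : Label → ℤ
𝟙⁺ l = 𝟙 (isPos l)
𝟙⁻ l = 𝟙 (isNeg l)

-- For the profile of x seen from v, `walks`, `mixed⁺⁻` and `mixed⁻⁺` are the (v, x) entries of A²,
-- PN and NP. The trailing zeros repeat the unfolding of `Σℤ` over `Fin 3`, so that `walks-profile`
-- and `balanced` need no rearrangement.
walks : Profile → ℤ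
walks ⟨ p₀ , p₁ , p₂ ∣ n₀ , n₁ , n₂ ⟩ =
  (adjEntry p₀ + (adjEntry p₁ + (adjEntry p₂ + + 0))) - (adjEntry n₀ + (adjEntry n₁ + (adjEntry n₂ + + 0)))

mixed⁺⁻ mixed⁻⁺ : Profile → ℤ
mixed⁺⁻ ⟨ p₀ , p₁ , p₂ ∣ n₀ , n₁ , n₂ ⟩ = 𝟙⁻ p₀ + (𝟙⁻ p₁ + (𝟙⁻ p₂ + + 0))
mixed⁻⁺ ⟨ p₀ , p₁ , p₂ ∣ n₀ , n₁ , n₂ ⟩ = 𝟙⁺ n₀ + (𝟙⁺ n₁ + (𝟙⁺ n₂ + + 0))

Balanced : Profile → Set
Balanced π = mixed⁺⁻ π ≡ mixed⁻⁺ π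

-- The surviving quadruples (a, b, X, Y).
spectrum : List (ℤ × ℤ × Label × Label)
spectrum =
  (+ 2 , + 0 , pos , none) ∷
  (+ 0 , + 2 , none , neg) ∷
  (+ 0 , + 0 , none , none) ∷
  (+ 4 , - + 4 , pos , pos) ∷
  (- + 4 , + 4 , neg , neg) ∷
  (+ 2 , + 2 , pos , neg) ∷
  (+ 2 , - + 4 , none , pos) ∷
  (- + 4 , + 2 , neg , none) ∷ []

-- The labels x run inside P(v), the labels y inside N(v), the labels z between the two;
-- uₛ and wₜ are the profiles of the vertices of P(v) and N(v).
local-types :
  ∀ x₀₁ x₀₂ z₀₀ z₀₁ z₀₂ → let u₀ = ⟨ none , x₀₁ , x₀₂ ∣ z₀₀ , z₀₁ , z₀₂ ⟩ in Balanced u₀ →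
  ∀ x₁₂ z₁₀ z₁₁ z₁₂ → let u₁ = ⟨ x₀₁ , none , x₁₂ ∣ z₁₀ , z₁₁ , z₁₂ ⟩ in
    Balanced u₁ → walks u₁ ≡ walks u₀ →
  ∀ z₂₀ z₂₁ z₂₂ → let u₂ = ⟨ x₀₂ , x₁₂ , none ∣ z₂₀ , z₂₁ , z₂₂ ⟩ in
    Balanced u₂ → walks u₂ ≡ walks u₀ →
  ∀ y₀₁ y₀₂ → let w₀ = ⟨ z₀₀ , z₁₀ , z₂₀ ∣ none , y₀₁ , y₀₂ ⟩ in Balanced w₀ →
  ∀ y₁₂ → let w₁ = ⟨ z₀₁ , z₁₁ , z₂₁ ∣ y₀₁ , none , y₁₂ ⟩
              w₂ = ⟨ z₀₂ , z₁₂ , z₂₂ ∣ y₀₂ , y₁₂ , none ⟩ in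
    Balanced w₁ → walks w₁ ≡ walks w₀ → Balanced w₂ → walks w₂ ≡ walks w₀ →
  (x₀₂ ≡ x₀₁ × x₁₂ ≡ x₀₁) × (y₀₂ ≡ y₀₁ × y₁₂ ≡ y₀₁) ×
  (walks u₀ , walks w₀ , x₀₁ , y₀₁) ∈ spectrum
-- Each hypothesis is tested as soon as its labels are fixed, which cuts failing branches before the
-- rest of the fifteen labels is enumerated.
local-types = toWitness {a? =
  ∀Label? λ x₀₁ → ∀Label? λ x₀₂ → ∀Label? λ z₀₀ → ∀Label? λ z₀₁ → ∀Label? λ z₀₂ →
    _ ℤ.≟ _ →-dec
  ∀Label? λ x₁₂ → ∀Label? λ z₁₀ → ∀Label? λ z₁₁ → ∀Label? λ z₁₂ →
    _ ℤ.≟ _ →-dec _ ℤ.≟ _ →-dec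
  ∀Label? λ z₂₀ → ∀Label? λ z₂₁ → ∀Label? λ z₂₂ →
    _ ℤ.≟ _ →-dec _ ℤ.≟ _ →-dec
  ∀Label? λ y₀₁ → ∀Label? λ y₀₂ → _ ℤ.≟ _ →-dec
  ∀Label? λ y₁₂ →
    _ ℤ.≟ _ →-dec _ ℤ.≟ _ →-dec _ ℤ.≟ _ →-dec _ ℤ.≟ _ →-dec
  (x₀₂ ≟ˡ x₀₁ ×-dec x₁₂ ≟ˡ x₀₁) ×-dec (y₀₂ ≟ˡ y₀₁ ×-dec y₁₂ ≟ˡ y₀₁) ×-dec
  Any.any? (λ _ → ≡-dec ℤ._≟_ (≡-dec ℤ._≟_ (≡-dec _≟ˡ_ _≟ˡ_)) _ _) spectrum} _

-- Finite sums, double counting and enumeration of subsets.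

private variable
  m n : ℕ

Σ-cong : {f g : Fin n → ℤ} → (∀ i → f i ≡ g i) → Σℤ f ≡ Σℤ g
Σ-cong {zero}  h = refl
Σ-cong {suc n} h = cong₂ _+_ (h zero) (Σ-cong (h ∘ suc))

Σ-+ : (f g : Fin n → ℤ) → Σℤ (λ i → f i + g i) ≡ Σℤ f + Σℤ g
Σ-+ {zero}  f g = refl
Σ-+ {suc n} f g rewrite Σ-+ (f ∘ suc) (g ∘ suc) = interchange (f zero) (g zero) (Σℤ (f ∘ suc)) (Σℤ (g ∘ suc))
  where
  interchange : ∀ w x y z → w + x + (y + z) ≡ w + y + (x + z)
  interchange = solve-∀

Σ-* : ∀ x (f : Fin n → ℤ) → Σℤ (λ i → x * f i) ≡ x * Σℤ f
Σ-* {zero}  x f = sym (ℤ.*-zeroʳ x)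
Σ-* {suc n} x f rewrite Σ-* x (f ∘ suc) = sym (ℤ.*-distribˡ-+ x _ _)

Σ-0 : ∀ n → Σℤ {n} (λ _ → + 0) ≡ + 0
Σ-0 zero    = refl
Σ-0 (suc n) = cong (λ s → + 0 + s) (Σ-0 n)

Σ-1 : ∀ n → Σℤ {n} (λ _ → + 1) ≡ + n
Σ-1 zero    = refl
Σ-1 (suc n) = cong (λ s → + 1 + s) (Σ-1 n)

Σ-const : ∀ n x → Σℤ {n} (λ _ → x) ≡ x * + n
Σ-const n x = begin
  Σℤ {n} (λ _ → x)       ≡⟨ Σ-cong {n} (λ _ → sym (ℤ.*-identityʳ x)) ⟩
  Σℤ {n} (λ _ → x * + 1) ≡⟨ Σ-* {n} x (λ _ → + 1) ⟩
  x * Σℤ {n} (λ _ → + 1) ≡⟨ cong (x *_) (Σ-1 n) ⟩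
  x * + n ∎
  where open ≡-Reasoning

Σ-- : (f g : Fin n → ℤ) → Σℤ (λ i → f i - g i) ≡ Σℤ f - Σℤ g
Σ-- {zero}  f g = refl
Σ-- {suc n} f g rewrite Σ-- (f ∘ suc) (g ∘ suc) = interchange (f zero) (g zero) (Σℤ (f ∘ suc)) (Σℤ (g ∘ suc))
  where
  interchange : ∀ w x y z → w - x + (y - z) ≡ w + y - (x + z)
  interchange = solve-∀

Σ-swap : (f : Fin m → Fin n → ℤ) → Σℤ (λ i → Σℤ (f i)) ≡ Σℤ (λ j → Σℤ (λ i → f i j))
Σ-swap {zero} {n} f = sym (Σ-0 n)
Σ-swap {suc m} f =
  trans (cong (λ s → Σℤ (f zero) + s) (Σ-swap (f ∘ suc))) (sym (Σ-+ (f zero) _))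

Σ-mono : {f g : Fin n → ℤ} → (∀ i → f i ≤ g i) → Σℤ f ≤ Σℤ g
Σ-mono {zero}  h = ℤ.≤-refl
Σ-mono {suc n} h = ℤ.+-mono-≤ (h zero) (Σ-mono (h ∘ suc))

Σ-nonneg : {f : Fin n → ℤ} → (∀ i → + 0 ≤ f i) → + 0 ≤ Σℤ f
Σ-nonneg {zero}  h = ℤ.≤-refl
Σ-nonneg {suc n} h = ℤ.+-mono-≤ (h zero) (Σ-nonneg (h ∘ suc))

term≤Σ : {f : Fin n → ℤ} → (∀ i → + 0 ≤ f i) → ∀ i → f i ≤ Σℤ f
term≤Σ {f = f} h zero    =
  ℤ.≤-trans (ℤ.≤-reflexive (sym (ℤ.+-identityʳ (f zero)))) (ℤ.+-monoʳ-≤ (f zero) (Σ-nonneg (h ∘ suc)))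
term≤Σ {f = f} h (suc i) = ℤ.≤-trans (term≤Σ (h ∘ suc) i)
  (ℤ.≤-trans (ℤ.≤-reflexive (sym (ℤ.+-identityˡ (Σℤ (f ∘ suc))))) (ℤ.+-monoˡ-≤ (Σℤ (f ∘ suc)) (h zero)))

δ : Fin n → Fin n → ℤ
δ i j = 𝟙 (does (i ≟ j))

Σ-δ : (i : Fin n) (f : Fin n → ℤ) → Σℤ (λ j → δ i j * f j) ≡ f i
Σ-δ {suc n} zero f = trans (cong (λ s → + 1 * f zero + s) (trans (Σ-cong λ j → ℤ.*-zeroˡ (f (suc j))) (Σ-0 n))) (unit _)
  where
  unit : ∀ x → + 1 * x + + 0 ≡ x
  unit = solve-∀
Σ-δ (suc i) f = trans (cong₂ _+_ (ℤ.*-zeroˡ (f zero)) (Σ-δ i (f ∘ suc))) (ℤ.+-identityˡ _)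

δ-sym : (i j : Fin n) → δ i j ≡ δ j i
δ-sym zero    zero    = refl
δ-sym zero    (suc j) = refl
δ-sym (suc i) zero    = refl
δ-sym (suc i) (suc j) = δ-sym i j

count-𝟙 : (χ : Fin n → Bool) → + count χ ≡ Σℤ (λ i → 𝟙 (χ i))
count-𝟙 {zero}  χ = refl
count-𝟙 {suc n} χ with χ zero
... | true  = cong (λ s → + 1 + s) (count-𝟙 (χ ∘ suc))
... | false = trans (count-𝟙 (χ ∘ suc)) (sym (ℤ.+-identityˡ _))

-- By symmetry the first row and the first column contribute the same sum r, and they meet in a
-- zero; removing both leaves a smaller symmetric array.
handshake : (f : Fin n → Fin n → ℤ) → (∀ i j → f i j ≡ f j i) → (∀ i → f i i ≡ + 0) →
  ∃ λ s → Σℤ (λ i → Σℤ (f i)) ≡ s + s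
handshake {zero}  f f-sym f-diag = + 0 , refl
handshake {suc n} f f-sym f-diag =
  let s , eq = handshake (λ i j → f (suc i) (suc j)) (λ i j → f-sym _ _) (λ i → f-diag _)
      r = Σℤ (λ j → f zero (suc j))
  in r + s , (begin
    f zero zero + r + Σℤ (λ i → f (suc i) zero + Σℤ (λ j → f (suc i) (suc j)))
      ≡⟨ cong₂ (λ x y → x + r + y) (f-diag zero) (Σ-+ (λ i → f (suc i) zero) _) ⟩
    + 0 + r + (Σℤ (λ i → f (suc i) zero) + Σℤ (λ i → Σℤ (λ j → f (suc i) (suc j))))
      ≡⟨ cong₂ (λ x y → + 0 + r + (x + y)) (Σ-cong (λ i → f-sym (suc i) zero)) eq ⟩
    + 0 + r + (r + (s + s)) ≡⟨ regroup r s ⟩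
    (r + s) + (r + s) ∎)
  where
  open ≡-Reasoning
  regroup : ∀ r s → + 0 + r + (r + (s + s)) ≡ (r + s) + (r + s)
  regroup = solve-∀

-- `Σ-at` replaces an indicator-weighted sum over all vertices by a sum over `Fin m`; for m = 3 the
-- latter unfolds to the three-term sums used for profiles.
record Enumeration (χ : Fin n → Bool) (m : ℕ) : Set where
  field
    at        : Fin m → Fin n
    sound     : ∀ i → χ (at i) ≡ true
    injective : ∀ {i j} → at i ≡ at j → i ≡ j
    complete  : ∀ x → χ x ≡ true → ∃ λ i → at i ≡ x
    Σ-at      : ∀ f → Σℤ (λ x → 𝟙 (χ x) * f x) ≡ Σℤ (f ∘ at)

enumerate : (χ : Fin n → Bool) → Enumeration χ (count χ)
enumerate {zero} χ = record
  { at = λ () ; sound = λ () ; injective = λ { {()} } ; complete = λ () ; Σ-at = λ f → refl }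
enumerate {suc n} χ with χ zero in χ0 | enumerate (χ ∘ suc)
... | true | e = record
  { at        = λ { zero → zero ; (suc i) → suc (at i) }
  ; sound     = λ { zero → χ0 ; (suc i) → sound i }
  ; injective = λ { {zero} {zero} _ → refl ; {suc i} {suc j} eq → cong suc (injective (suc-injective eq)) }
  ; complete  = λ { zero _ → zero , refl ; (suc x) h → let i , eq = complete x h in suc i , cong suc eq }
  ; Σ-at      = λ f → cong₂ _+_ (trans (cong (λ b → 𝟙 b * f zero) χ0) (ℤ.*-identityˡ _)) (Σ-at (f ∘ suc))
  }
  where open Enumeration e
... | false | e = record
  { at        = suc ∘ at
  ; sound     = sound
  ; injective = injective ∘ suc-injective
  ; complete  = λ { zero h → contradiction (trans (sym χ0) h) λ () ; (suc x) h → let i , eq = complete x h in i , cong suc eq }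
  ; Σ-at      = λ f → trans (cong₂ _+_ (cong (λ b → 𝟙 b * f zero) χ0) (Σ-at (f ∘ suc)))
                       (trans (cong (_+ Σℤ (f ∘ suc ∘ at)) (ℤ.*-zeroˡ (f zero))) (ℤ.+-identityˡ _))
  }
  where open Enumeration e

-- Signed graphs with three positive and three negative edges at each vertex.

adjEntry-split : ∀ l → adjEntry l ≡ 𝟙⁺ l - 𝟙⁻ l
adjEntry-split none = refl
adjEntry-split pos  = refl
adjEntry-split neg  = refl

module Regular33 {n : ℕ} (L : Fin n → Fin n → Label) (sg : IsSignedGraph L)
  (deg⁺ : ∀ v → d⁺ L v ≡ 3) (deg⁻ : ∀ v → d⁻ L v ≡ 3) where

  open IsSignedGraph sg

  p q : Fin n → Fin n → ℤ
  p i j = 𝟙⁺ (L i j)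
  q i j = 𝟙⁻ (L i j)

  p-sym : ∀ i j → p i j ≡ p j i
  p-sym i j = cong 𝟙⁺ (symmetric i j)

  q-sym : ∀ i j → q i j ≡ q j i
  q-sym i j = cong 𝟙⁻ (symmetric i j)

  A-sym : ∀ i j → A L i j ≡ A L j i
  A-sym i j = cong adjEntry (symmetric i j)

  abstract
    enumerate⁺ : ∀ v → Enumeration (isPos ∘ L v) 3
    enumerate⁺ v = subst (Enumeration _) (deg⁺ v) (enumerate _)

    enumerate⁻ : ∀ v → Enumeration (isNeg ∘ L v) 3
    enumerate⁻ v = subst (Enumeration _) (deg⁻ v) (enumerate _)

  module N⁺ v = Enumeration (enumerate⁺ v)
  module N⁻ v = Enumeration (enumerate⁻ v)

  P N : Fin n → Fin 3 → Fin n
  P = N⁺.at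
  N = N⁻.at

  isPos⁻¹ : ∀ {l} → isPos l ≡ true → l ≡ pos
  isPos⁻¹ {pos} _ = refl

  isNeg⁻¹ : ∀ {l} → isNeg l ≡ true → l ≡ neg
  isNeg⁻¹ {neg} _ = refl

  L-P : ∀ v t → L v (P v t) ≡ pos
  L-P v t = isPos⁻¹ (N⁺.sound v t)

  L-N : ∀ v t → L v (N v t) ≡ neg
  L-N v t = isNeg⁻¹ (N⁻.sound v t)

  P-complete : ∀ {v x} → L v x ≡ pos → ∃ λ t → P v t ≡ x
  P-complete {v} {x} h = N⁺.complete v x (cong isPos h)

  N-complete : ∀ {v x} → L v x ≡ neg → ∃ λ t → N v t ≡ x
  N-complete {v} {x} h = N⁻.complete v x (cong isNeg h)

  A-step : ∀ v (f : Fin n → ℤ) → Σℤ (λ k → A L v k * f k) ≡ Σℤ (f ∘ P v) - Σℤ (f ∘ N v)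
  A-step v f = begin
    Σℤ (λ k → A L v k * f k)
      ≡⟨ Σ-cong (λ k → trans (cong (_* f k) (adjEntry-split (L v k))) (distrib (p v k) (q v k) (f k))) ⟩
    Σℤ (λ k → p v k * f k - q v k * f k) ≡⟨ Σ-- (λ k → p v k * f k) _ ⟩
    Σℤ (λ k → p v k * f k) - Σℤ (λ k → q v k * f k) ≡⟨ cong₂ _-_ (N⁺.Σ-at v f) (N⁻.Σ-at v f) ⟩
    Σℤ (f ∘ P v) - Σℤ (f ∘ N v) ∎
    where
    open ≡-Reasoning
    distrib : ∀ x y z → (x - y) * z ≡ x * z - y * z
    distrib = solve-∀

  A-row : ∀ v → Σℤ (A L v) ≡ + 0
  A-row v = trans (Σ-cong λ k → sym (ℤ.*-identityʳ (A L v k))) (A-step v (λ _ → + 1))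

  p-row : ∀ v → Σℤ (p v) ≡ + 3
  p-row v = trans (sym (count-𝟙 (isPos ∘ L v))) (cong +_ (deg⁺ v))

  q-row : ∀ v → Σℤ (q v) ≡ + 3
  q-row v = trans (sym (count-𝟙 (isNeg ∘ L v))) (cong +_ (deg⁻ v))

  A²-diag : ∀ v → A² L v v ≡ + 6
  A²-diag v = trans (A-step v (λ k → A L k v)) (cong₂ _-_ (Σ-cong pos₁) (Σ-cong neg₁))
    where
    pos₁ : ∀ t → A L (P v t) v ≡ + 1
    pos₁ t = cong adjEntry (trans (symmetric _ _) (L-P v t))
    neg₁ : ∀ t → A L (N v t) v ≡ - + 1
    neg₁ t = cong adjEntry (trans (symmetric _ _) (L-N v t))

  -- The entries of P sum to 3n, which is even by `handshake`; as 3n = 2n + n, so is n.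
  even-order : 2 ∣ n
  even-order = ∣m+n∣m⇒∣n (divides ∣ s ∣ (begin
      n ℕ.* 2 ℕ.+ n         ≡⟨ ℕ.+-comm (n ℕ.* 2) n ⟩
      n ℕ.+ n ℕ.* 2         ≡⟨ sym (ℕ.*-suc n 2) ⟩
      n ℕ.* 3               ≡⟨ ℕ.*-comm n 3 ⟩
      3 ℕ.* n               ≡⟨ sym (ℤ.abs-* (+ 3) (+ n)) ⟩
      ∣ + 3 * + n ∣         ≡⟨ cong ∣_∣ (sym (Σ-const n (+ 3))) ⟩
      ∣ Σℤ {n} (λ _ → + 3) ∣ ≡⟨ cong ∣_∣ (Σ-cong λ v → sym (p-row v)) ⟩
      ∣ Σℤ (λ v → Σℤ (p v)) ∣ ≡⟨ cong ∣_∣ (proj₂ double) ⟩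
      ∣ s + s ∣             ≡⟨ cong ∣_∣ (twice s) ⟩
      ∣ s * + 2 ∣           ≡⟨ ℤ.abs-* s (+ 2) ⟩
      ∣ s ∣ ℕ.* 2           ∎))
    (divides n refl)
    where
    open ≡-Reasoning
    double = handshake p p-sym (λ i → cong 𝟙⁺ (irreflexive i))
    s = proj₁ double
    twice : ∀ s → s + s ≡ s * + 2
    twice = solve-∀

  -- The indicator of distinct non-adjacent pairs.
  o : Fin n → Fin n → ℤ
  o i j = + 1 - δ i j - p i j - q i j

  -- The square of A and the commutation of P and N.

  module Square (a b c : ℤ)
    (A²-pos : ∀ i j → L i j ≡ pos → A² L i j ≡ a)
    (A²-neg : ∀ i j → L i j ≡ neg → A² L i j ≡ b)
    (A²-non : ∀ i j → i ≢ j → L i j ≡ none → A² L i j ≡ c) where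

    -- The indices hold the values of `L`, `δ`, `o` and `A²` at (i, j), so that matching on
    -- `pair i j` turns a relation between these entries into one explicit instance per kind of
    -- pair.
    data Pair (i j : Fin n) : Label → ℤ → ℤ → ℤ → Set where
      equal    : i ≡ j → Pair i j none (+ 1) (+ 0) (+ 6)
      positive : Pair i j pos (+ 0) (+ 0) a
      negative : Pair i j neg (+ 0) (+ 0) b
      distant  : i ≢ j → Pair i j none (+ 0) (+ 1) c

    pair : ∀ i j → Pair i j (L i j) (δ i j) (o i j) (A² L i j)
    pair i j with i ≟ j | L i j in Lij
    ... | yes refl | pos  with () ← trans (sym (irreflexive i)) Lij
    ... | yes refl | neg  with () ← trans (sym (irreflexive i)) Lij
    ... | yes refl | none rewrite A²-diag i           = equal refl
    ... | no i≢j   | pos  rewrite A²-pos i j Lij      = positive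
    ... | no i≢j   | neg  rewrite A²-neg i j Lij      = negative
    ... | no i≢j   | none rewrite A²-non i j i≢j Lij  = distant i≢j

    o-nonneg : ∀ i j → + 0 ≤ o i j
    o-nonneg i j with L i j | δ i j | o i j | A² L i j | pair i j
    ... | _ | _ | _ | _ | equal _   = ℤ.+≤+ ℕ.z≤n
    ... | _ | _ | _ | _ | positive  = ℤ.+≤+ ℕ.z≤n
    ... | _ | _ | _ | _ | negative  = ℤ.+≤+ ℕ.z≤n
    ... | _ | _ | _ | _ | distant _ = ℤ.+≤+ ℕ.z≤n

    -- By the definition of `o`, the indicators `δ`, `p`, `q` and `o` add up to one.
    Σ-around : ∀ v (f : Fin n → ℤ) →
      Σℤ f ≡ f v + Σℤ (f ∘ P v) + Σℤ (f ∘ N v) + Σℤ (λ x → o v x * f x)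
    Σ-around v f = begin
      Σℤ f ≡⟨ Σ-cong (λ x → partition (δ v x) (p v x) (q v x) (f x)) ⟩
      Σℤ (λ x → δ v x * f x + p v x * f x + q v x * f x + o v x * f x)
        ≡⟨ Σ-+ (λ x → δ v x * f x + p v x * f x + q v x * f x) _ ⟩
      Σℤ (λ x → δ v x * f x + p v x * f x + q v x * f x) + O
        ≡⟨ cong (_+ O) (Σ-+ (λ x → δ v x * f x + p v x * f x) _) ⟩
      Σℤ (λ x → δ v x * f x + p v x * f x) + Σℤ (λ x → q v x * f x) + O
        ≡⟨ cong (λ s → s + Σℤ (λ x → q v x * f x) + O) (Σ-+ (λ x → δ v x * f x) _) ⟩
      Σℤ (λ x → δ v x * f x) + Σℤ (λ x → p v x * f x) + Σℤ (λ x → q v x * f x) + O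
        ≡⟨ cong₂ (λ s t → s + t + O) (cong₂ _+_ (Σ-δ v f) (N⁺.Σ-at v f)) (N⁻.Σ-at v f) ⟩
      f v + Σℤ (f ∘ P v) + Σℤ (f ∘ N v) + O ∎
      where
      open ≡-Reasoning
      O = Σℤ (λ x → o v x * f x)
      partition : ∀ d p q x → x ≡ d * x + p * x + q * x + (+ 1 - d - p - q) * x
      partition = solve-∀

    -- A annihilates the all-ones vector by `A-row`, hence so does A².
    A²-row : ∀ v → Σℤ (A² L v) ≡ + 0
    A²-row v = begin
      Σℤ (λ x → Σℤ (λ k → A L v k * A L k x)) ≡⟨ Σ-swap (λ x k → A L v k * A L k x) ⟩
      Σℤ (λ k → Σℤ (λ x → A L v k * A L k x)) ≡⟨ Σ-cong (λ k → Σ-* (A L v k) (A L k)) ⟩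
      Σℤ (λ k → A L v k * Σℤ (A L k))
        ≡⟨ Σ-cong (λ k → trans (cong (A L v k *_) (A-row k)) (ℤ.*-zeroʳ (A L v k))) ⟩
      Σℤ {n} (λ _ → + 0) ≡⟨ Σ-0 n ⟩
      + 0 ∎
      where open ≡-Reasoning

    order : ∀ v → + n ≡ + 7 + Σℤ (o v)
    order v = begin
      + n ≡⟨ sym (Σ-1 n) ⟩
      Σℤ {n} (λ _ → + 1) ≡⟨ Σ-around v (λ _ → + 1) ⟩
      + 7 + Σℤ (λ x → o v x * + 1) ≡⟨ cong (λ s → + 7 + s) (Σ-cong λ x → ℤ.*-identityʳ (o v x)) ⟩
      + 7 + Σℤ (o v) ∎
      where open ≡-Reasoning

    -- The vanishing row sum of A², split by `Σ-around` into the diagonal, P(v), N(v) and the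
    -- non-neighbours.
    row-equation : ∀ v → + 6 + a * + 3 + b * + 3 + c * Σℤ (o v) ≡ + 0
    row-equation v = begin
      + 6 + a * + 3 + b * + 3 + c * Σℤ (o v)
        ≡⟨ cong₂ _+_ (cong₂ _+_ (cong₂ _+_ (sym (A²-diag v)) (three (P v) a λ t → A²-pos v _ (L-P v t)))
                       (three (N v) b λ t → A²-neg v _ (L-N v t))) (trans (sym (Σ-* c (o v))) (Σ-cong far)) ⟩
      A² L v v + Σℤ (A² L v ∘ P v) + Σℤ (A² L v ∘ N v) + Σℤ (λ x → o v x * A² L v x) ≡⟨ sym (Σ-around v (A² L v)) ⟩
      Σℤ (A² L v) ≡⟨ A²-row v ⟩
      + 0 ∎
      where
      open ≡-Reasoning
      three : (e : Fin 3 → Fin n) (y : ℤ) → (∀ t → A² L v (e t) ≡ y) → y * + 3 ≡ Σℤ (A² L v ∘ e)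
      three e y h = trans (sym (Σ-const 3 y)) (Σ-cong (sym ∘ h))
      far : ∀ x → c * o v x ≡ o v x * A² L v x
      far x with L v x | δ v x | o v x | A² L v x | pair v x
      ... | _ | _ | _ | _ | equal _   = ℤ.*-zeroʳ c
      ... | _ | _ | _ | _ | positive  = ℤ.*-zeroʳ c
      ... | _ | _ | _ | _ | negative  = ℤ.*-zeroʳ c
      ... | _ | _ | _ | _ | distant _ = ℤ.*-comm c (+ 1)

    d : ℤ
    d = a + b - + 2 * c

    B : Fin n → Fin n → ℤ
    B i j = p i j + q i j

    -- The four kinds of pairs determine 2A² as a combination of B = P + N, A, I and J, in which B
    -- has coefficient `d`; this is that combination solved for `d * B`, and the constant term is
    -- the multiple of J.
    dB≡ : ∀ i j → d * B i j ≡
      + 2 * A² L i j + (+ 2 * c - + 12) * δ i j + - (+ 2 * c) + (b - a) * A L i j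
    dB≡ i j with L i j | δ i j | o i j | A² L i j | pair i j
    ... | _ | _ | _ | _ | equal _   = e a b c
      where
      e : ∀ a b c → (a + b - + 2 * c) * + 0 ≡ + 2 * + 6 + (+ 2 * c - + 12) * + 1 + - (+ 2 * c) + (b - a) * + 0
      e = solve-∀
    ... | _ | _ | _ | _ | positive  = e a b c
      where
      e : ∀ a b c → (a + b - + 2 * c) * + 1 ≡ + 2 * a + (+ 2 * c - + 12) * + 0 + - (+ 2 * c) + (b - a) * + 1
      e = solve-∀
    ... | _ | _ | _ | _ | negative  = e a b c
      where
      e : ∀ a b c → (a + b - + 2 * c) * + 1 ≡ + 2 * b + (+ 2 * c - + 12) * + 0 + - (+ 2 * c) + (b - a) * - + 1
      e = solve-∀
    ... | _ | _ | _ | _ | distant _ = e a b c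
      where
      e : ∀ a b c → (a + b - + 2 * c) * + 0 ≡ + 2 * c + (+ 2 * c - + 12) * + 0 + - (+ 2 * c) + (b - a) * + 0
      e = solve-∀

    A³ AB : Fin n → Fin n → ℤ
    A³ i j = Σℤ (λ k → A L i k * A² L k j)
    AB i j = Σℤ (λ k → A L i k * B k j)

    A²-sym : ∀ i j → A² L i j ≡ A² L j i
    A²-sym i j = Σ-cong λ k → trans (cong₂ _*_ (A-sym i k) (A-sym k j)) (ℤ.*-comm (A L k i) (A L j k))

    -- Reversing a walk of length three keeps the product of its signs.
    A³-sym : ∀ i j → A³ i j ≡ A³ j i
    A³-sym i j = begin
      Σℤ (λ k → A L i k * A² L k j)
        ≡⟨ Σ-cong (λ k → sym (Σ-* (A L i k) (λ l → A L k l * A L l j))) ⟩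
      Σℤ (λ k → Σℤ (λ l → A L i k * (A L k l * A L l j)))
        ≡⟨ Σ-swap (λ k l → A L i k * (A L k l * A L l j)) ⟩
      Σℤ (λ l → Σℤ (λ k → A L i k * (A L k l * A L l j)))
        ≡⟨ Σ-cong (λ l → Σ-cong λ k → reverse l k) ⟩
      Σℤ (λ l → Σℤ (λ k → A L j l * (A L l k * A L k i)))
        ≡⟨ Σ-cong (λ l → Σ-* (A L j l) (λ k → A L l k * A L k i)) ⟩
      Σℤ (λ l → A L j l * A² L l i) ∎
      where
      open ≡-Reasoning
      flip₃ : ∀ x y z → x * (y * z) ≡ z * (y * x)
      flip₃ = solve-∀
      reverse : ∀ l k → A L i k * (A L k l * A L l j) ≡ A L j l * (A L l k * A L k i)
      reverse l k = trans (flip₃ (A L i k) (A L k l) (A L l j))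
        (cong₂ _*_ (A-sym l j) (cong₂ _*_ (A-sym k l) (A-sym i k)))

    -- `dB≡` multiplied by A from the left. The multiple of J drops out because the rows of A sum to
    -- zero, and what remains is a polynomial in A, hence symmetric.
    dAB≡ : ∀ i j → d * AB i j ≡ + 2 * A³ i j + (+ 2 * c - + 12) * A L i j + (b - a) * A² L i j
    dAB≡ i j = begin
      d * AB i j ≡⟨ sym (Σ-* d (λ k → A L i k * B k j)) ⟩
      Σℤ (λ k → d * (A L i k * B k j)) ≡⟨ Σ-cong pointwise ⟩
      Σℤ (λ k → f₁ k + f₂ k + f₃ k + f₄ k)
        ≡⟨ trans (Σ-+ (λ k → f₁ k + f₂ k + f₃ k) f₄)
             (cong (_+ Σℤ f₄) (trans (Σ-+ (λ k → f₁ k + f₂ k) f₃) (cong (_+ Σℤ f₃) (Σ-+ f₁ f₂)))) ⟩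
      Σℤ f₁ + Σℤ f₂ + Σℤ f₃ + Σℤ f₄
        ≡⟨ cong₂ _+_ (cong₂ _+_ (cong₂ _+_ (Σ-* (+ 2) (λ k → A L i k * A² L k j)) eq₂) eq₃)
             (Σ-* (b - a) (λ k → A L i k * A L k j)) ⟩
      + 2 * A³ i j + e * A L i j + + 0 + (b - a) * A² L i j
        ≡⟨ cong (_+ (b - a) * A² L i j) (ℤ.+-identityʳ (+ 2 * A³ i j + e * A L i j)) ⟩
      + 2 * A³ i j + e * A L i j + (b - a) * A² L i j ∎
      where
      open ≡-Reasoning
      e = + 2 * c - + 12
      f₁ f₂ f₃ f₄ : Fin n → ℤ
      f₁ k = + 2 * (A L i k * A² L k j)
      f₂ k = e * (A L i k * δ k j)
      f₃ k = - (+ 2 * c) * A L i k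
      f₄ k = (b - a) * (A L i k * A L k j)
      swap₃ : ∀ x y z → x * (y * z) ≡ y * (x * z)
      swap₃ = solve-∀
      expand : ∀ x s e t c u y → x * (+ 2 * s + e * t + - (+ 2 * c) + u * y) ≡
        + 2 * (x * s) + e * (x * t) + - (+ 2 * c) * x + u * (x * y)
      expand = solve-∀
      pointwise : ∀ k → d * (A L i k * B k j) ≡ f₁ k + f₂ k + f₃ k + f₄ k
      pointwise k = trans (swap₃ d (A L i k) (B k j)) (trans (cong (A L i k *_) (dB≡ k j))
        (expand (A L i k) (A² L k j) e (δ k j) c (b - a) (A L k j)))
      eq₂ : Σℤ f₂ ≡ e * A L i j
      eq₂ = trans (Σ-* e (λ k → A L i k * δ k j)) (cong (e *_)
        (trans (Σ-cong λ k → trans (ℤ.*-comm (A L i k) (δ k j)) (cong (_* A L i k) (δ-sym k j)))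
               (Σ-δ j (A L i))))
      eq₃ : Σℤ f₃ ≡ + 0
      eq₃ = trans (Σ-* (- (+ 2 * c)) (A L i)) (trans (cong (- (+ 2 * c) *_) (A-row i)) (ℤ.*-zeroʳ (- (+ 2 * c))))

    AB-sym : .{{ℤ.NonZero d}} → ∀ i j → AB i j ≡ AB j i
    AB-sym i j = ℤ.*-cancelˡ-≡ d (AB i j) (AB j i) (begin
      d * AB i j ≡⟨ dAB≡ i j ⟩
      + 2 * A³ i j + (+ 2 * c - + 12) * A L i j + (b - a) * A² L i j
        ≡⟨ cong₂ _+_ (cong₂ (λ x y → + 2 * x + (+ 2 * c - + 12) * y) (A³-sym i j) (A-sym i j))
             (cong ((b - a) *_) (A²-sym i j)) ⟩
      + 2 * A³ j i + (+ 2 * c - + 12) * A L j i + (b - a) * A² L j i ≡⟨ sym (dAB≡ j i) ⟩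
      d * AB j i ∎)
      where open ≡-Reasoning

    -- As A and B are symmetric, `AB j i` is the (i, j) entry of BA. With A = P - N and B = P + N,
    -- the difference AB - BA is 2(PN - NP), and it vanishes by `AB-sym`.
    PN≡NP : .{{ℤ.NonZero d}} → ∀ i j → Σℤ (λ t → q (P i t) j) ≡ Σℤ (λ t → p (N i t) j)
    PN≡NP i j = ℤ.*-cancelˡ-≡ (+ 2) _ _ (ℤ.i-j≡0⇒i≡j _ _ (begin
      + 2 * Σℤ (λ t → q (P i t) j) - + 2 * Σℤ (λ t → p (N i t) j)
        ≡⟨ cong₂ (λ x y → + 2 * x - + 2 * y) (sym (N⁺.Σ-at i (λ k → q k j))) (sym (N⁻.Σ-at i (λ k → p k j))) ⟩
      + 2 * Σℤ (λ k → p i k * q k j) - + 2 * Σℤ (λ k → q i k * p k j)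
        ≡⟨ cong₂ _-_ (sym (Σ-* (+ 2) (λ k → p i k * q k j))) (sym (Σ-* (+ 2) (λ k → q i k * p k j))) ⟩
      Σℤ (λ k → + 2 * (p i k * q k j)) - Σℤ (λ k → + 2 * (q i k * p k j))
        ≡⟨ sym (Σ-- (λ k → + 2 * (p i k * q k j)) _) ⟩
      Σℤ (λ k → + 2 * (p i k * q k j) - + 2 * (q i k * p k j)) ≡⟨ Σ-cong (sym ∘ pointwise) ⟩
      Σℤ (λ k → A L i k * B k j - A L j k * B k i) ≡⟨ Σ-- (λ k → A L i k * B k j) _ ⟩
      AB i j - AB j i ≡⟨ ℤ.i≡j⇒i-j≡0 (AB-sym i j) ⟩
      + 0 ∎))
      where
      open ≡-Reasoning
      expand : ∀ x y z w → (x - y) * (z + w) - (z - w) * (x + y) ≡ + 2 * (x * w) - + 2 * (y * z)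
      expand = solve-∀
      A-split : ∀ i k → A L i k ≡ p i k - q i k
      A-split i k = adjEntry-split (L i k)
      pointwise : ∀ k → A L i k * B k j - A L j k * B k i ≡ + 2 * (p i k * q k j) - + 2 * (q i k * p k j)
      pointwise k = trans
        (cong₂ _-_ (cong (_* B k j) (A-split i k))
          (cong₂ _*_ (trans (A-sym j k) (A-split k j)) (cong₂ _+_ (p-sym k i) (q-sym k i))))
        (expand (p i k) (q i k) (p k j) (q k j))

-- Grids from two commuting equivalence relations.

record Class {n : ℕ} (R : Fin n → Fin n → Set) (v : Fin n) (k : ℕ) : Set where
  field
    member    : Fin k → Fin n
    related   : ∀ i → R v (member i)
    injective : ∀ {i j} → member i ≡ member j → i ≡ j
    complete  : ∀ {x} → R v x → ∃ λ i → member i ≡ x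

-- Two commuting equivalence relations that meet trivially and jointly connect all
-- vertices are the "same row" and "same column" relations of a rectangular grid.
module Grid {n k l : ℕ} (L : Fin n → Fin n → Label) (connected : Connected L)
  {R S : Fin n → Fin n → Set} (R-equiv : IsEquivalence R) (S-equiv : IsEquivalence S)
  (meet : ∀ {x y} → R x y → S x y → x ≡ y)
  (RS⇒SR : ∀ {x y z} → R x y → S y z → ∃ λ w → S x w × R w z)
  (edge : ∀ {x y} → L x y ≢ none → ∃ λ w → S x w × R w y)
  (v₀ : Fin n) (R-class : Class R v₀ k) (S-class : Class S v₀ l)
  where

  private
    module R = IsEquivalence R-equiv
    module S = IsEquivalence S-equiv
    module RC = Class R-class
    module SC = Class S-class

  SR⇒RS : ∀ {x y z} → S x y → R y z → ∃ λ w → R x w × S w z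
  SR⇒RS Sxy Ryz = let w , Szw , Rwx = RS⇒SR (R.sym Ryz) (S.sym Sxy) in w , R.sym Rwx , S.sym Szw

  -- Each edge is an S-step followed by an R-step; `RS⇒SR` moves the R-step past the S-step of the
  -- remaining walk, and transitivity merges the steps.
  join : ∀ {x y} → Walk L x y → ∃ λ w → S x w × R w y
  join here       = _ , S.refl , R.refl
  join (step e p) =
    let _ , Sxw , Rwy = edge e
        _ , Syz , Rzt = join p
        _ , Sws , Rsz = RS⇒SR Rwy Syz
    in _ , S.trans Sxw Sws , R.trans Rsz Rzt

  abstract
    -- Rows are indexed by the S-class of v₀: by `join`, x is reached from v₀ by first moving within
    -- that class and then within a row. Columns are indexed dually by the R-class of v₀.
    row-spec : ∀ x → ∃ λ i → R (SC.member i) x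
    row-spec x with join (connected v₀ x)
    ... | y , Sv₀y , Ryx with SC.complete Sv₀y
    ... | i , refl = i , Ryx

    column-spec : ∀ x → ∃ λ j → S (RC.member j) x
    column-spec x with join (connected v₀ x)
    ... | y , Sv₀y , Ryx with SR⇒RS Sv₀y Ryx
    ... | w , Rv₀w , Swx with RC.complete Rv₀w
    ... | j , refl = j , Swx

  row : Fin n → Fin l
  row = proj₁ ∘ row-spec

  column : Fin n → Fin k
  column = proj₁ ∘ column-spec

  -- Two members of the S-class of v₀ in one row coincide by `meet`.
  row-unique : ∀ {i x} → R (SC.member i) x → row x ≡ i
  row-unique {i} {x} Rix = SC.injective (meet (R.trans (proj₂ (row-spec x)) (R.sym Rix))
    (S.trans (S.sym (SC.related _)) (SC.related i)))

  column-unique : ∀ {j x} → S (RC.member j) x → column x ≡ j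
  column-unique {j} {x} Sjx = RC.injective (meet (R.trans (R.sym (RC.related _)) (RC.related j))
    (S.trans (proj₂ (column-spec x)) (S.sym Sjx)))

  R⇒row : ∀ {x y} → R x y → row x ≡ row y
  R⇒row Rxy = row-unique (R.trans (proj₂ (row-spec _)) (R.sym Rxy))

  S⇒column : ∀ {x y} → S x y → column x ≡ column y
  S⇒column Sxy = column-unique (S.trans (proj₂ (column-spec _)) (S.sym Sxy))

  row⇒R : ∀ {x y} → row x ≡ row y → R x y
  row⇒R {x} {y} eq = R.trans (R.sym (proj₂ (row-spec x)))
    (subst (λ i → R (SC.member i) y) (sym eq) (proj₂ (row-spec y)))

  column⇒S : ∀ {x y} → column x ≡ column y → S x y
  column⇒S {x} {y} eq = S.trans (S.sym (proj₂ (column-spec x)))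
    (subst (λ j → S (RC.member j) y) (sym eq) (proj₂ (column-spec y)))

  -- The path from the i-th row head through v₀ to the j-th column head, with its two steps
  -- exchanged.
  point-spec : ∀ i j → ∃ λ x → R (SC.member i) x × S x (RC.member j)
  point-spec i j = SR⇒RS (S.sym (SC.related i)) (RC.related j)

  point : Fin l → Fin k → Fin n
  point i j = proj₁ (point-spec i j)

  row-point : ∀ i j → row (point i j) ≡ i
  row-point i j = row-unique (proj₁ (proj₂ (point-spec i j)))

  column-point : ∀ i j → column (point i j) ≡ j
  column-point i j = column-unique (S.sym (proj₂ (proj₂ (point-spec i j))))

  point-coordinates : ∀ x → point (row x) (column x) ≡ x
  point-coordinates x = meet (row⇒R (row-point (row x) (column x))) (column⇒S (column-point (row x) (column x)))

  bijection : Fin n ↔ Fin (l ℕ.* k)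
  bijection = mk↔ₛ′ to from to∘from from∘to
    where
    to : Fin n → Fin (l ℕ.* k)
    to x = combine (row x) (column x)
    from : Fin (l ℕ.* k) → Fin n
    from u = let i , j = remQuot k u in point i j
    to∘from : ∀ u → to (from u) ≡ u
    to∘from u = let i , j = remQuot k u in
      trans (cong₂ combine (row-point i j) (column-point i j)) (combine-remQuot {l} k u)
    from∘to : ∀ x → from (to x) ≡ x
    from∘to x = trans (cong (λ (i , j) → point i j) (remQuot-combine (row x) (column x))) (point-coordinates x)

  grid-iso : (lab : Fin l × Fin k → Fin l × Fin k → Label) →
    (∀ x y → lab (row x , column x) (row y , column y) ≡ L x y) →
    L ≅ λ u v → lab (remQuot k u) (remQuot k v)
  grid-iso lab h = bijection , λ x y →
    trans (cong₂ lab (remQuot-combine (row x) (column x)) (remQuot-combine (row y) (column y))) (h x y)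

-- Finite tables on profiles and the surviving types.

∀Profile? : {Q : Profile → Set} → (∀ π → Dec (Q π)) → Dec (∀ π → Q π)
∀Profile? Q? = map′ (λ h → λ { ⟨ p₀ , p₁ , p₂ ∣ n₀ , n₁ , n₂ ⟩ → h p₀ p₁ p₂ n₀ n₁ n₂ }) (λ h _ _ _ _ _ _ → h _)
  (∀Label? λ _ → ∀Label? λ _ → ∀Label? λ _ → ∀Label? λ _ → ∀Label? λ _ → ∀Label? λ _ → Q? _)

_≟ᵖ_ : DecidableEquality Profile
⟨ p₀ , p₁ , p₂ ∣ n₀ , n₁ , n₂ ⟩ ≟ᵖ ⟨ p₀′ , p₁′ , p₂′ ∣ n₀′ , n₁′ , n₂′ ⟩ = map′
  (λ { (refl , refl , refl , refl , refl , refl) → refl }) (λ { refl → refl , refl , refl , refl , refl , refl })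
  (p₀ ≟ˡ p₀′ ×-dec p₁ ≟ˡ p₁′ ×-dec p₂ ≟ˡ p₂′ ×-dec n₀ ≟ˡ n₀′ ×-dec n₁ ≟ˡ n₁′ ×-dec n₂ ≟ˡ n₂′)

-- The profile of y₁ seen from x₁ in Ṡ⁴₈.
antipodal : Profile
antipodal = ⟨ neg , neg , neg ∣ pos , pos , pos ⟩

abstract
  -- The eight pairs (a, b) in the list are distinct.
  spectrum-functional : ∀ {α β X Y X′ Y′} →
    (α , β , X , Y) ∈ spectrum → (α , β , X′ , Y′) ∈ spectrum → X ≡ X′ × Y ≡ Y′
  spectrum-functional h h′ = All.lookup (All.lookup table h) h′ refl refl
    where
    table : All.All (λ (α , β , X , Y) → All.All (λ (α′ , β′ , X′ , Y′) →
      α ≡ α′ → β ≡ β′ → X ≡ X′ × Y ≡ Y′) spectrum) spectrum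
    table = toWitness {a? = All.all? (λ (α , β , X , Y) → All.all? (λ (α′ , β′ , X′ , Y′) →
      α ℤ.≟ α′ →-dec β ℤ.≟ β′ →-dec X ≟ˡ X′ ×-dec Y ≟ˡ Y′) spectrum) spectrum} _

  -- Three mixed walks in one order force three in the other, and the profile is then `antipodal`.
  mixed-bound : ∀ π → Balanced π → mixed⁺⁻ π ≤ + 3 × (mixed⁺⁻ π ≤ + 2 ⊎ walks π ≡ - + 6)
  mixed-bound = toWitness {a? = ∀Profile? λ π →
    _ ℤ.≟ _ →-dec _ ℤ.≤? _ ×-dec (_ ℤ.≤? _ ⊎-dec _ ℤ.≟ _)} _

  -- Each of the six labels contributes at least -1.
  walks-minimal : ∀ π → walks π ≡ - + 6 → π ≡ antipodal
  walks-minimal = toWitness {a? = ∀Profile? λ π → _ ℤ.≟ _ →-dec _ ≟ᵖ _} _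

abstract
  saturated⁺ : ∀ π → Balanced π → Profile.p₀ π ≡ neg → Profile.p₁ π ≡ neg → Profile.p₂ π ≡ neg → π ≡ antipodal
  saturated⁺ = toWitness {a? = ∀Profile? λ π → _ ℤ.≟ _ →-dec _ ≟ˡ _ →-dec _ ≟ˡ _ →-dec _ ≟ˡ _ →-dec _ ≟ᵖ _} _

  saturated⁻ : ∀ π → Balanced π → Profile.n₀ π ≡ pos → Profile.n₁ π ≡ pos → Profile.n₂ π ≡ pos → π ≡ antipodal
  saturated⁻ = toWitness {a? = ∀Profile? λ π → _ ℤ.≟ _ →-dec _ ≟ˡ _ →-dec _ ≟ˡ _ →-dec _ ≟ˡ _ →-dec _ ≟ᵖ _} _

-- In a `sparse` type no mixed walk from v ends in P(v) or N(v), and the row equation makes m equal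
-- to -c times the number of non-neighbours. The `closing` types fail at another vertex, and
-- `negated` is settled by passing to the negation.
data Outcome (α β : ℤ) (X Y : Label) : Set where
  sparse   : X ≢ neg → Y ≢ pos → ∀ m → + 6 + α * + 3 + β * + 3 ≡ + m → m ∣ 12 → Outcome α β X Y
  cliques  : X ≡ pos → Y ≡ pos → Outcome α β X Y
  negated  : α ≡ - + 4 → β ≡ + 4 → Outcome α β X Y
  grid     : X ≡ pos → Y ≡ neg → Outcome α β X Y
  closing⁻ : Y ≡ pos → X ≢ pos → Outcome α β X Y
  closing⁺ : X ≡ neg → Y ≢ neg → Outcome α β X Y

outcome : ∀ {α β X Y} → (α , β , X , Y) ∈ spectrum → Outcome α β X Y
outcome (here refl) = sparse (λ ()) (λ ()) 12 refl (divides 1 refl)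
outcome (there (here refl)) = sparse (λ ()) (λ ()) 12 refl (divides 1 refl)
outcome (there (there (here refl))) = sparse (λ ()) (λ ()) 6 refl (divides 2 refl)
outcome (there (there (there (here refl)))) = cliques refl refl
outcome (there (there (there (there (here refl))))) = negated refl refl
outcome (there (there (there (there (there (here refl)))))) = grid refl refl
outcome (there (there (there (there (there (there (here refl))))))) = closing⁻ refl (λ ())
outcome (there (there (there (there (there (there (there (here refl)))))))) = closing⁺ refl (λ ())

-- The odd divisors of 12 are 1 and 3.
no-odd-divisor : ∀ {K} → K ∣ 12 → 2 ∣ 7 ℕ.+ K → ¬ 9 ℕ.≤ 2 ℕ.* K
no-odd-divisor {K} K∣12 = subst (λ K → K ∣ 12 → 2 ∣ 7 ℕ.+ K → ¬ 9 ℕ.≤ 2 ℕ.* K) (toℕ-fromℕ< K<13) (table (fromℕ< K<13)) K∣12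
  where
  K<13 : K ℕ.< 13
  K<13 = ℕ.s≤s (∣⇒≤ K∣12)
  table : (i : Fin 13) → toℕ i ∣ 12 → 2 ∣ 7 ℕ.+ toℕ i → ¬ 9 ℕ.≤ 2 ℕ.* toℕ i
  table = toWitness {a? = all? λ i → toℕ i ∣? 12 →-dec 2 ∣? (7 ℕ.+ toℕ i) →-dec 9 ℕ.≤? 2 ℕ.* toℕ i →-dec no (λ ())} _

-- The labels inside P(v) and N(v).

module Classify {n : ℕ} (L : Fin n → Fin n → Label) (sg : IsSignedGraph L) (connected : Connected L)
  (deg⁺ : ∀ v → d⁺ L v ≡ 3) (deg⁻ : ∀ v → d⁻ L v ≡ 3) (a b c : ℤ)
  (A²-pos : ∀ i j → L i j ≡ pos → A² L i j ≡ a)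
  (A²-neg : ∀ i j → L i j ≡ neg → A² L i j ≡ b)
  (A²-non : ∀ i j → i ≢ j → L i j ≡ none → A² L i j ≡ c)
  (v₀ : Fin n) where

  open IsSignedGraph sg
  open Regular33 L sg deg⁺ deg⁻
  open Square a b c A²-pos A²-neg A²-non

  -- The number n - 7 of non-neighbours of v₀ other than v₀.
  κ : ℕ
  κ = ∣ Σℤ (o v₀) ∣

  Σo≡κ : Σℤ (o v₀) ≡ + κ
  Σo≡κ = sym (ℤ.0≤i⇒+∣i∣≡i (Σ-nonneg (o-nonneg v₀)))

  n≡7+κ : n ≡ 7 ℕ.+ κ
  n≡7+κ = ℤ.+-injective (trans (order v₀) (cong (λ s → + 7 + s) Σo≡κ))

  2∣7+κ : 2 ∣ 7 ℕ.+ κ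
  2∣7+κ = subst (2 ∣_) n≡7+κ even-order

  row-eq : + 6 + a * + 3 + b * + 3 + c * + κ ≡ + 0
  row-eq = trans (cong (λ s → + 6 + a * + 3 + b * + 3 + c * s) (sym Σo≡κ)) (row-equation v₀)

  -- d ≡ 0 turns the row equation into c (n - 1) = -6, which forces the odd order n = 7.
  d≢0 : d ≢ + 0
  d≢0 d≡0 = from-no (2 ∣? 7) (subst (λ K → 2 ∣ 7 ℕ.+ K) κ≡0 2∣7+κ)
    where
    open ≡-Reasoning
    combine-eqs : ∀ a b c k → (+ 6 + k) * c ≡ + 6 + a * + 3 + b * + 3 + c * k - + 3 * (a + b - + 2 * c) - + 6
    combine-eqs = solve-∀
    product : (+ 6 + + κ) * c ≡ - + 6
    product = trans (combine-eqs a b c (+ κ)) (cong₂ (λ x y → x - + 3 * y - + 6) row-eq d≡0)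
    6+κ∣6 : 6 ℕ.+ κ ∣ 6
    6+κ∣6 = divides ∣ c ∣ (trans (cong ∣_∣ (sym product)) (trans (ℤ.abs-* (+ 6 + + κ) c) (ℕ.*-comm (6 ℕ.+ κ) ∣ c ∣)))
    κ≡0 : κ ≡ 0
    κ≡0 = ℕ.n≤0⇒n≡0 (ℕ.+-cancelˡ-≤ 6 κ 0 (∣⇒≤ 6+κ∣6))

  instance
    d-nonZero : ℤ.NonZero d
    d-nonZero = ℤ.≢-nonZero d≢0

  profile : Fin n → Fin n → Profile
  profile v x = ⟨ L (P v zero) x , L (P v (suc zero)) x , L (P v (suc (suc zero))) x
                ∣ L (N v zero) x , L (N v (suc zero)) x , L (N v (suc (suc zero))) x ⟩

  walks-profile : ∀ v x → walks (profile v x) ≡ A² L v x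
  walks-profile v x = sym (A-step v (λ k → A L k x))

  balanced : ∀ v x → Balanced (profile v x)
  balanced v x = PN≡NP v x

  record Links (v : Fin n) (X Y : Label) : Set where
    field
      P-link : ∀ s t → s ≢ t → L (P v s) (P v t) ≡ X
      N-link : ∀ s t → s ≢ t → L (N v s) (N v t) ≡ Y

  -- An instance of `local-types`: `balanced` supplies the balance hypotheses, and the walk sums are
  -- a for all of P(v) and b for all of N(v).
  links-at : ∀ v → ∃₂ λ X Y → (a , b , X , Y) ∈ spectrum × Links v X Y
  links-at v = X , Y , in-spectrum , record
    { P-link = triangle (P v) x₀₂≡ x₁₂≡ ; N-link = triangle (N v) y₀₂≡ y₁₂≡ }
    where
    pattern 0′ = zero
    pattern 1′ = suc zero
    pattern 2′ = suc (suc zero)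
    X = L (P v 0′) (P v 1′)
    Y = L (N v 0′) (N v 1′)
    triangle : (e : Fin 3 → Fin n) → L (e 0′) (e 2′) ≡ L (e 0′) (e 1′) → L (e 1′) (e 2′) ≡ L (e 0′) (e 1′) →
      ∀ s t → s ≢ t → L (e s) (e t) ≡ L (e 0′) (e 1′)
    triangle e h₀₂ h₁₂ 0′ 0′ ne = contradiction refl ne
    triangle e h₀₂ h₁₂ 0′ 1′ ne = refl
    triangle e h₀₂ h₁₂ 0′ 2′ ne = h₀₂
    triangle e h₀₂ h₁₂ 1′ 0′ ne = symmetric _ _
    triangle e h₀₂ h₁₂ 1′ 1′ ne = contradiction refl ne
    triangle e h₀₂ h₁₂ 1′ 2′ ne = h₁₂
    triangle e h₀₂ h₁₂ 2′ 0′ ne = trans (symmetric _ _) h₀₂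
    triangle e h₀₂ h₁₂ 2′ 1′ ne = trans (symmetric _ _) h₁₂
    triangle e h₀₂ h₁₂ 2′ 2′ ne = contradiction refl ne
    profile-≡ : ∀ {x₀ x₁ x₂ x₃ x₄ x₅ y₀ y₁ y₂ y₃ y₄ y₅} →
      x₀ ≡ y₀ → x₁ ≡ y₁ → x₂ ≡ y₂ → x₃ ≡ y₃ → x₄ ≡ y₄ → x₅ ≡ y₅ →
      ⟨ x₀ , x₁ , x₂ ∣ x₃ , x₄ , x₅ ⟩ ≡ ⟨ y₀ , y₁ , y₂ ∣ y₃ , y₄ , y₅ ⟩
    profile-≡ refl refl refl refl refl refl = refl
    irr : ∀ {x} → L x x ≡ none
    irr = irreflexive _
    flip : ∀ {x y} → L x y ≡ L y x
    flip = symmetric _ _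
    -- The profiles are brought to the form in `local-types`: loops become `none`, and each edge
    -- appears in one orientation only.
    u₀≡ : profile v (P v 0′) ≡ ⟨ none , L (P v 0′) (P v 1′) , L (P v 0′) (P v 2′) ∣ _ , _ , _ ⟩
    u₀≡ = profile-≡ irr flip flip refl refl refl
    u₁≡ : profile v (P v 1′) ≡ ⟨ L (P v 0′) (P v 1′) , none , L (P v 1′) (P v 2′) ∣ _ , _ , _ ⟩
    u₁≡ = profile-≡ refl irr flip refl refl refl
    u₂≡ : profile v (P v 2′) ≡ ⟨ L (P v 0′) (P v 2′) , L (P v 1′) (P v 2′) , none ∣ _ , _ , _ ⟩
    u₂≡ = profile-≡ refl refl irr refl refl refl
    w₀≡ : profile v (N v 0′) ≡ ⟨ L (N v 0′) (P v 0′) , L (N v 0′) (P v 1′) , L (N v 0′) (P v 2′)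
                               ∣ none , L (N v 0′) (N v 1′) , L (N v 0′) (N v 2′) ⟩
    w₀≡ = profile-≡ flip flip flip irr flip flip
    w₁≡ : profile v (N v 1′) ≡ ⟨ L (N v 1′) (P v 0′) , L (N v 1′) (P v 1′) , L (N v 1′) (P v 2′)
                               ∣ L (N v 0′) (N v 1′) , none , L (N v 1′) (N v 2′) ⟩
    w₁≡ = profile-≡ flip flip flip refl irr flip
    w₂≡ : profile v (N v 2′) ≡ ⟨ L (N v 2′) (P v 0′) , L (N v 2′) (P v 1′) , L (N v 2′) (P v 2′)
                               ∣ L (N v 0′) (N v 2′) , L (N v 1′) (N v 2′) , none ⟩
    w₂≡ = profile-≡ flip flip flip refl refl irr
    bal : ∀ {x π} → profile v x ≡ π → Balanced π
    bal eq = subst Balanced eq (balanced v _)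
    val⁺ : ∀ {t π} → profile v (P v t) ≡ π → walks π ≡ a
    val⁺ {t} eq = trans (cong walks (sym eq)) (trans (walks-profile v (P v t)) (A²-pos v _ (L-P v t)))
    val⁻ : ∀ {t π} → profile v (N v t) ≡ π → walks π ≡ b
    val⁻ {t} eq = trans (cong walks (sym eq)) (trans (walks-profile v (N v t)) (A²-neg v _ (L-N v t)))
    z : Fin 3 → Fin 3 → Label
    z s t = L (N v t) (P v s)
    result = local-types _ _ (z 0′ 0′) (z 0′ 1′) (z 0′ 2′) (bal u₀≡)
      _ (z 1′ 0′) (z 1′ 1′) (z 1′ 2′) (bal u₁≡) (trans (val⁺ u₁≡) (sym (val⁺ u₀≡)))
      (z 2′ 0′) (z 2′ 1′) (z 2′ 2′) (bal u₂≡) (trans (val⁺ u₂≡) (sym (val⁺ u₀≡)))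
      _ _ (bal w₀≡) _ (bal w₁≡) (trans (val⁻ w₁≡) (sym (val⁻ w₀≡)))
      (bal w₂≡) (trans (val⁻ w₂≡) (sym (val⁻ w₀≡)))
    x₀₂≡ = proj₁ (proj₁ result)
    x₁₂≡ = proj₂ (proj₁ result)
    y₀₂≡ = proj₁ (proj₁ (proj₂ result))
    y₁₂≡ = proj₂ (proj₁ (proj₂ result))
    in-spectrum : (a , b , X , Y) ∈ spectrum
    in-spectrum = subst₂ (λ α β → (α , β , X , Y) ∈ spectrum) (val⁺ u₀≡) (val⁻ w₀≡) (proj₂ (proj₂ result))

  abstract
    links : ∀ v → ∃₂ λ X Y → (a , b , X , Y) ∈ spectrum × Links v X Y
    links = links-at

  -- The pair (a, b) is the same at all vertices, and by `spectrum-functional` it determines X and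
  -- Y.
  uniform : ∃₂ λ X Y → (a , b , X , Y) ∈ spectrum × (∀ v → Links v X Y)
  uniform = go (links v₀)
    where
    go : (∃₂ λ X Y → (a , b , X , Y) ∈ spectrum × Links v₀ X Y) →
      ∃₂ λ X Y → (a , b , X , Y) ∈ spectrum × (∀ v → Links v X Y)
    go (X , Y , h₀ , _) = X , Y , h₀ , λ v → same (links v)
      where
      same : ∀ {v} → (∃₂ λ X′ Y′ → (a , b , X′ , Y′) ∈ spectrum × Links v X′ Y′) → Links v X Y
      same {v} (_ , _ , h , ℓ) =
        subst₂ (Links v) (proj₁ (spectrum-functional h h₀)) (proj₂ (spectrum-functional h h₀)) ℓ

-- Exclusion of the sparse and closing types.

module Uniform {n : ℕ} (L : Fin n → Fin n → Label) (sg : IsSignedGraph L) (connected : Connected L)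
  (deg⁺ : ∀ v → d⁺ L v ≡ 3) (deg⁻ : ∀ v → d⁻ L v ≡ 3) (a b c : ℤ)
  (A²-pos : ∀ i j → L i j ≡ pos → A² L i j ≡ a)
  (A²-neg : ∀ i j → L i j ≡ neg → A² L i j ≡ b)
  (A²-non : ∀ i j → i ≢ j → L i j ≡ none → A² L i j ≡ c)
  (v₀ : Fin n) (X Y : Label)
  (uniform-links : ∀ v → Classify.Links L sg connected deg⁺ deg⁻ a b c A²-pos A²-neg A²-non v₀ v X Y) where

  open IsSignedGraph sg
  open Regular33 L sg deg⁺ deg⁻
  open Square a b c A²-pos A²-neg A²-non
  open Classify L sg connected deg⁺ deg⁻ a b c A²-pos A²-neg A²-non v₀ hiding (uniform)

  P-link : ∀ {v x y} → L v x ≡ pos → L v y ≡ pos → x ≢ y → L x y ≡ X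
  P-link {v} vx vy x≢y with P-complete vx | P-complete vy
  ... | s , refl | t , refl = Links.P-link (uniform-links v) s t (x≢y ∘ cong (P v))

  N-link : ∀ {v x y} → L v x ≡ neg → L v y ≡ neg → x ≢ y → L x y ≡ Y
  N-link {v} vx vy x≢y with N-complete vx | N-complete vy
  ... | s , refl | t , refl = Links.N-link (uniform-links v) s t (x≢y ∘ cong (N v))

  L-sym : ∀ {x y l} → L x y ≡ l → L y x ≡ l
  L-sym = trans (symmetric _ _)

  𝟙⁺-nonneg : ∀ l → + 0 ≤ 𝟙⁺ l
  𝟙⁺-nonneg none = ℤ.+≤+ ℕ.z≤n
  𝟙⁺-nonneg pos  = ℤ.+≤+ ℕ.z≤n
  𝟙⁺-nonneg neg  = ℤ.+≤+ ℕ.z≤n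

  𝟙⁻-nonneg : ∀ l → + 0 ≤ 𝟙⁻ l
  𝟙⁻-nonneg none = ℤ.+≤+ ℕ.z≤n
  𝟙⁻-nonneg pos  = ℤ.+≤+ ℕ.z≤n
  𝟙⁻-nonneg neg  = ℤ.+≤+ ℕ.z≤n

  𝟙⁺-≢pos : ∀ l → l ≢ pos → 𝟙⁺ l ≡ + 0
  𝟙⁺-≢pos none _ = refl
  𝟙⁺-≢pos neg  _ = refl
  𝟙⁺-≢pos pos  h = contradiction refl h

  𝟙⁻-≢neg : ∀ l → l ≢ neg → 𝟙⁻ l ≡ + 0
  𝟙⁻-≢neg none _ = refl
  𝟙⁻-≢neg pos  _ = refl
  𝟙⁻-≢neg neg  h = contradiction refl h

  -- The walk through y makes the (x, z) entry of PN, hence that of NP, at least one.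
  PN⇒NP : ∀ {x y z} → L x y ≡ pos → L y z ≡ neg → ∃ λ w → L x w ≡ neg × L w z ≡ pos
  PN⇒NP {x} {y} {z} xy yz with any? (λ t → L (N x t) z ≟ˡ pos)
  ... | yes (t , h) = N x t , L-N x t , h
  ... | no none⁺ with P-complete xy
  ... | s , refl = ⊥-elim (ℤ.<⇒≱ (ℤ.+<+ ℕ.z<s) (begin
      + 1 ≡⟨ cong 𝟙⁻ (sym yz) ⟩
      q (P x s) z ≤⟨ term≤Σ (λ t → 𝟙⁻-nonneg (L (P x t) z)) s ⟩
      Σℤ (λ t → q (P x t) z) ≡⟨ PN≡NP x z ⟩
      Σℤ (λ t → p (N x t) z) ≡⟨ Σ-cong (λ t → 𝟙⁺-≢pos _ (λ h → none⁺ (t , h))) ⟩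
      + 0 ∎))
    where open ℤ.≤-Reasoning

  -- If Y is positive, N(v₀) is a positive triangle: two of its vertices are positive neighbours of
  -- the third, and the label between them is X.
  Y≡pos⇒X≡pos : Y ≡ pos → X ≡ pos
  Y≡pos⇒X≡pos Y≡pos = trans (sym (P-link {N v₀ zero} (link zero (suc zero) λ ()) (link zero (suc (suc zero)) λ ())
      (λ eq → contradiction (N⁻.injective v₀ eq) λ ()))) (link (suc zero) (suc (suc zero)) λ ())
    where
    link : ∀ s t → s ≢ t → L (N v₀ s) (N v₀ t) ≡ pos
    link s t s≢t = trans (Links.N-link (uniform-links v₀) s t s≢t) Y≡pos

  X≡neg⇒Y≡neg : X ≡ neg → Y ≡ neg
  X≡neg⇒Y≡neg X≡neg = trans (sym (N-link {P v₀ zero} (link zero (suc zero) λ ()) (link zero (suc (suc zero)) λ ())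
      (λ eq → contradiction (N⁺.injective v₀ eq) λ ()))) (link (suc zero) (suc (suc zero)) λ ())
    where
    link : ∀ s t → s ≢ t → L (P v₀ s) (P v₀ t) ≡ neg
    link s t s≢t = trans (Links.P-link (uniform-links v₀) s t s≢t) X≡neg

  -- The (v, x) entry of PN, which unfolds to `mixed⁺⁻ (profile v x)`.
  mixed : Fin n → Fin n → ℤ
  mixed v x = Σℤ (λ t → q (P v t) x)

  -- There are 3 · 3 positive-negative walks from v. None returns to v, and none ends in P(v) since
  -- X is not negative. One ending in N(v) could be traded by PN = NP for a walk whose last edge is
  -- a positive edge inside N(v), which Y forbids.
  mixed-total : X ≢ neg → Y ≢ pos → ∀ v → Σℤ (λ x → o v x * mixed v x) ≡ + 9
  mixed-total X≢neg Y≢pos v = begin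
    Σℤ (λ x → o v x * mixed v x) ≡⟨ sym (ℤ.+-identityˡ _) ⟩
    + 0 + Σℤ (λ x → o v x * mixed v x) ≡⟨ cong₂ _+_ (sym near) refl ⟩
    mixed v v + Σℤ (mixed v ∘ P v) + Σℤ (mixed v ∘ N v) + Σℤ (λ x → o v x * mixed v x) ≡⟨ sym (Σ-around v (mixed v)) ⟩
    Σℤ (mixed v) ≡⟨ Σ-swap (λ x t → q (P v t) x) ⟩
    Σℤ (λ t → Σℤ (q (P v t))) ≡⟨ Σ-cong (λ t → q-row (P v t)) ⟩
    + 9 ∎
    where
    open ≡-Reasoning
    at-v : mixed v v ≡ + 0
    at-v = Σ-cong (λ t → cong 𝟙⁻ (L-sym (L-P v t)))
    at-P : ∀ s → mixed v (P v s) ≡ + 0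
    at-P s = Σ-cong {g = λ _ → + 0} λ t → 𝟙⁻-≢neg _ (not-neg t)
      where
      not-neg : ∀ t → L (P v t) (P v s) ≢ neg
      not-neg t h with t ≟ s
      ... | yes refl with () ← trans (sym h) (irreflexive (P v s))
      ... | no t≢s   = X≢neg (trans (sym (Links.P-link (uniform-links v) t s t≢s)) h)
    at-N : ∀ s → mixed v (N v s) ≡ + 0
    at-N s = trans (PN≡NP v (N v s)) (Σ-cong {g = λ _ → + 0} λ t → 𝟙⁺-≢pos _ (not-pos t))
      where
      not-pos : ∀ t → L (N v t) (N v s) ≢ pos
      not-pos t h with t ≟ s
      ... | yes refl with () ← trans (sym h) (irreflexive (N v s))
      ... | no t≢s   = Y≢pos (trans (sym (Links.N-link (uniform-links v) t s t≢s)) h)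
    near : mixed v v + Σℤ (mixed v ∘ P v) + Σℤ (mixed v ∘ N v) ≡ + 0
    near = cong₂ _+_ (cong₂ _+_ at-v (Σ-cong at-P)) (Σ-cong at-N)

  mixed-bounded : X ≢ neg → Y ≢ pos → (m : ℕ) → (∀ x → v₀ ≢ x → L v₀ x ≡ none → mixed v₀ x ≤ + m) → 9 ℕ.≤ m ℕ.* κ
  mixed-bounded X≢neg Y≢pos m mixed≤m = ℤ.drop‿+≤+ (begin
    + 9 ≡⟨ sym (mixed-total X≢neg Y≢pos v₀) ⟩
    Σℤ (λ x → o v₀ x * mixed v₀ x) ≤⟨ Σ-mono pointwise ⟩
    Σℤ (λ x → + m * o v₀ x) ≡⟨ Σ-* (+ m) (o v₀) ⟩
    + m * Σℤ (o v₀) ≡⟨ cong (+ m *_) Σo≡κ ⟩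
    + m * + κ ≡⟨ sym (ℤ.pos-* m κ) ⟩
    + (m ℕ.* κ) ∎)
    where
    open ℤ.≤-Reasoning
    pointwise : ∀ x → o v₀ x * mixed v₀ x ≤ + m * o v₀ x
    pointwise x with L v₀ x | δ v₀ x | o v₀ x | A² L v₀ x | pair v₀ x | mixed≤m x
    ... | _ | _ | _ | _ | equal _   | _ = ℤ.≤-reflexive (trans (ℤ.*-zeroˡ (mixed v₀ x)) (sym (ℤ.*-zeroʳ (+ m))))
    ... | _ | _ | _ | _ | positive  | _ = ℤ.≤-reflexive (trans (ℤ.*-zeroˡ (mixed v₀ x)) (sym (ℤ.*-zeroʳ (+ m))))
    ... | _ | _ | _ | _ | negative  | _ = ℤ.≤-reflexive (trans (ℤ.*-zeroˡ (mixed v₀ x)) (sym (ℤ.*-zeroʳ (+ m))))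
    ... | _ | _ | _ | _ | distant x≢ | h = ℤ.≤-trans (ℤ.≤-reflexive (ℤ.*-identityˡ (mixed v₀ x)))
      (ℤ.≤-trans (h x≢ refl) (ℤ.≤-reflexive (sym (ℤ.*-identityʳ (+ m)))))

  mixed≤ : ∀ v x → mixed v x ≤ + 3 × (mixed v x ≤ + 2 ⊎ walks (profile v x) ≡ - + 6)
  mixed≤ v x = mixed-bound (profile v x) (balanced v x)

  ∣c∣κ : ∀ {m} → + 6 + a * + 3 + b * + 3 ≡ + m → m ≡ ∣ c ∣ ℕ.* κ
  ∣c∣κ {m} eq = begin
    m               ≡⟨ sym (ℤ.∣-i∣≡∣i∣ (+ m)) ⟩
    ∣ - + m ∣       ≡⟨ cong ∣_∣ (sym c*κ≡-m) ⟩
    ∣ c * + κ ∣     ≡⟨ ℤ.abs-* c (+ κ) ⟩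
    ∣ c ∣ ℕ.* κ     ∎
    where
    open ≡-Reasoning
    cancel : ∀ x y → y ≡ x + y - x
    cancel = solve-∀
    c*κ≡-m : c * + κ ≡ - + m
    c*κ≡-m = trans (cancel (+ 6 + a * + 3 + b * + 3) (c * + κ))
      (trans (cong₂ _-_ row-eq eq) (ℤ.+-identityˡ (- + m)))

  -- As κ is odd and divides 12, there are at most three non-neighbours of v₀, too few to
  -- receive the nine mixed walks: each takes at most two of them, or three if c = -6.
  too-few-walks : X ≢ neg → Y ≢ pos → ∀ {m} → + 6 + a * + 3 + b * + 3 ≡ + m → ¬ m ∣ 12
  too-few-walks X≢neg Y≢pos {m} eq m∣12 with c ℤ.≟ - + 6
  -- Here m = 6κ, and 9 ≤ 3κ gives m ≥ 18, against m ≤ 12.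
  ... | yes c≡-6 = from-no (18 ℕ.≤? 12) (begin
      18 ≤⟨ ℕ.*-monoʳ-≤ 2 (mixed-bounded X≢neg Y≢pos 3 λ x _ _ → proj₁ (mixed≤ v₀ x)) ⟩
      2 ℕ.* (3 ℕ.* κ) ≡⟨ sym (ℕ.*-assoc 2 3 κ) ⟩
      6 ℕ.* κ ≡⟨ cong (λ c → ∣ c ∣ ℕ.* κ) (sym c≡-6) ⟩
      ∣ c ∣ ℕ.* κ ≡⟨ sym m≡∣c∣κ ⟩
      m ≤⟨ ∣⇒≤ m∣12 ⟩
      12 ∎)
    where
    open ℕ.≤-Reasoning
    m≡∣c∣κ = ∣c∣κ eq
  ... | no c≢-6 =
    no-odd-divisor (∣-trans (divides ∣ c ∣ (∣c∣κ eq)) m∣12) 2∣7+κ (mixed-bounded X≢neg Y≢pos 2 bound)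
    where
    bound : ∀ x → v₀ ≢ x → L v₀ x ≡ none → mixed v₀ x ≤ + 2
    bound x x≢ non = [ id , (λ h → contradiction
      (trans (sym (A²-non v₀ x x≢ non)) (trans (sym (walks-profile v₀ x)) h)) c≢-6) ]′ (proj₂ (mixed≤ v₀ x))

  -- Recognition of Ṡ₁₆ and Ṡ⁴₈.

  Closed : Label → Fin n → Fin n → Set
  Closed l x y = x ≡ y ⊎ L x y ≡ l

  closed-equivalence : ∀ {l} → (∀ {v x y} → L v x ≡ l → L v y ≡ l → x ≢ y → L x y ≡ l) →
    IsEquivalence (Closed l)
  closed-equivalence {l} triangle = record { refl = inj₁ refl ; sym = closed-sym ; trans = closed-trans }
    where
    closed-sym : ∀ {x y} → Closed l x y → Closed l y x
    closed-sym (inj₁ eq) = inj₁ (sym eq)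
    closed-sym (inj₂ xy) = inj₂ (L-sym xy)
    closed-trans : ∀ {x y z} → Closed l x y → Closed l y z → Closed l x z
    closed-trans (inj₁ refl) yz = yz
    closed-trans (inj₂ xy) (inj₁ refl) = inj₂ xy
    closed-trans {x} {z = z} (inj₂ xy) (inj₂ yz) with x ≟ z
    ... | yes x≡z = inj₁ x≡z
    ... | no  x≢z = inj₂ (triangle (L-sym xy) yz x≢z)

  closed-class : ∀ {l} → l ≢ none → (v : Fin n) (e : Fin 3 → Fin n) → (∀ t → L v (e t) ≡ l) →
    (∀ {s t} → e s ≡ e t → s ≡ t) → (∀ {x} → L v x ≡ l → ∃ λ t → e t ≡ x) → Class (Closed l) v 4
  closed-class {l} l≢none v e e-sound e-injective e-complete = record
    { member = member ; related = related ; injective = λ {i} {j} → injective i j ; complete = complete }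
    where
    member : Fin 4 → Fin n
    member zero    = v
    member (suc t) = e t
    related : ∀ i → Closed l v (member i)
    related zero    = inj₁ refl
    related (suc t) = inj₂ (e-sound t)
    apart : ∀ t → v ≢ e t
    apart t v≡ = l≢none (trans (sym (e-sound t)) (trans (cong (L v) (sym v≡)) (irreflexive v)))
    injective : ∀ i j → member i ≡ member j → i ≡ j
    injective zero    zero    _  = refl
    injective zero    (suc t) eq = contradiction eq (apart t)
    injective (suc s) zero    eq = contradiction (sym eq) (apart s)
    injective (suc s) (suc t) eq = cong suc (e-injective eq)
    complete : ∀ {x} → Closed l v x → ∃ λ i → member i ≡ x
    complete (inj₁ refl) = zero , refl
    complete (inj₂ vx)   = let t , eq = e-complete vx in suc t , eq

  R : Fin n → Fin n → Set
  R = Closed pos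

  R-class : Class R v₀ 4
  R-class = closed-class (λ ()) v₀ (P v₀) (L-P v₀) (N⁺.injective v₀) P-complete

  clash : ∀ {x y k l} → L x y ≡ k → L x y ≡ l → k ≢ l → ⊥
  clash h h′ k≢l = k≢l (trans (sym h) h′)

  -- Rows are the positive cliques and columns the negative ones, with four vertices each; `PN⇒NP`
  -- is their commutation.
  grid-S16 : X ≡ pos → Y ≡ neg → L ≅ S16
  grid-S16 X≡pos Y≡neg = grid-iso S16-lab labels
    where
    S : Fin n → Fin n → Set
    S = Closed neg
    meet : ∀ {x y} → R x y → S x y → x ≡ y
    meet (inj₁ eq) _         = eq
    meet (inj₂ _)  (inj₁ eq) = eq
    meet (inj₂ xy) (inj₂ yx) = ⊥-elim (clash xy yx λ ())
    RS⇒SR : ∀ {x y z} → R x y → S y z → ∃ λ w → S x w × R w z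
    RS⇒SR (inj₁ refl) yz          = _ , yz , inj₁ refl
    RS⇒SR (inj₂ xy)   (inj₁ refl) = _ , inj₁ refl , inj₂ xy
    RS⇒SR (inj₂ xy)   (inj₂ yz)   = let w , xw , wz = PN⇒NP xy yz in w , inj₂ xw , inj₂ wz
    edge : ∀ {x y} → L x y ≢ none → ∃ λ w → S x w × R w y
    edge {x} {y} xy with L x y in eq
    ... | none = contradiction refl xy
    ... | pos  = x , inj₁ refl , inj₂ eq
    ... | neg  = y , inj₂ eq , inj₁ refl
    R-equiv : IsEquivalence R
    R-equiv = closed-equivalence λ vx vy x≢y → trans (P-link vx vy x≢y) X≡pos
    S-equiv : IsEquivalence S
    S-equiv = closed-equivalence λ vx vy x≢y → trans (N-link vx vy x≢y) Y≡neg
    S-class : Class S v₀ 4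
    S-class = closed-class (λ ()) v₀ (N v₀) (L-N v₀) (N⁻.injective v₀) N-complete
    open Grid L connected R-equiv S-equiv meet RS⇒SR edge v₀ R-class S-class
    label : Bool → Bool → Label
    label same-row same-column =
      if same-row ∧ not same-column then pos else (if same-column ∧ not same-row then neg else none)
    by-coordinates : ∀ x y → label (does (row x ≟ row y)) (does (column x ≟ column y)) ≡ L x y
    by-coordinates x y with row x ≟ row y | column x ≟ column y
    ... | yes r | yes s = sym (trans (cong (L x) (sym (meet (row⇒R r) (column⇒S s)))) (irreflexive x))
    ... | yes r | no ¬s = [ (λ x≡y → contradiction (cong column x≡y) ¬s) , sym ]′ (row⇒R r)
    ... | no ¬r | yes s = [ (λ x≡y → contradiction (cong row x≡y) ¬r) , sym ]′ (column⇒S s)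
    ... | no ¬r | no ¬s with L x y in eq
    ... | none = refl
    ... | pos  = contradiction (R⇒row (inj₂ eq)) ¬r
    ... | neg  = contradiction (S⇒column (inj₂ eq)) ¬s
    labels : ∀ x y → S16-lab (row x , column x) (row y , column y) ≡ L x y
    labels = by-coordinates

  -- Rows are the positive 4-cliques and columns the non-adjacent pairs. One antipode forces c = -6,
  -- and this value makes every non-neighbour an antipode, so that it is unique.
  cliques-S48 : X ≡ pos → Y ≡ pos → L ≅ S48
  cliques-S48 X≡pos Y≡pos = grid-iso S48-lab labels
    where
    Far : Fin n → Fin n → Set
    Far x y = x ≢ y × L x y ≡ none
    N-pos : ∀ {v x y} → L v x ≡ neg → L v y ≡ neg → x ≢ y → L x y ≡ pos
    N-pos vx vy x≢y = trans (N-link vx vy x≢y) Y≡pos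
    P-pos : ∀ {v x y} → L v x ≡ pos → L v y ≡ pos → x ≢ y → L x y ≡ pos
    P-pos vx vy x≢y = trans (P-link vx vy x≢y) X≡pos
    -- Otherwise the adjacent vertices w and u would be antipodal.
    third : ∀ {u w} → L u w ≡ neg → ∃ λ t → L (P w t) u ≢ neg
    third {u} {w} uw with any? (λ t → ¬? (L (P w t) u ≟ˡ neg))
    ... | yes h = h
    ... | no ¬h =
      let _ , Nwj≡u = N-complete (L-sym uw)
      in ⊥-elim (clash (trans (cong (L u) Nwj≡u) (irreflexive u)) (L-sym (full⇒N full _)) λ ())
      where
      neg-at : ∀ t → L (P w t) u ≡ neg
      neg-at t = decidable-stable (L (P w t) u ≟ˡ neg) (λ h → ¬h (t , h))
      full : profile w u ≡ antipodal
      full = saturated⁺ (profile w u) (balanced w u) (neg-at zero) (neg-at (suc zero)) (neg-at (suc (suc zero)))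
      full⇒N : profile w u ≡ antipodal → ∀ t → L (N w t) u ≡ pos
      full⇒N eq zero             = cong Profile.n₀ eq
      full⇒N eq (suc zero)       = cong Profile.n₁ eq
      full⇒N eq (suc (suc zero)) = cong Profile.n₂ eq
    -- Take w₀ in N(u) and a positive neighbour y of w₀ with uy not negative. Nor is uy positive, as
    -- u and w₀ would both lie in P(y) and be positively joined. The rest of N(u) is positively
    -- joined to w₀, as y is, hence to y.
    antipode-spec : ∀ u → ∃ λ y → Far u y × (∀ {w} → L u w ≡ neg → L w y ≡ pos)
    antipode-spec u = y , (u≢y , uy) , near
      where
      w₀ = N u zero
      uw₀ = L-N u zero
      y = P w₀ (proj₁ (third uw₀))
      w₀y : L w₀ y ≡ pos
      w₀y = L-P w₀ _
      u≢y : u ≢ y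
      u≢y eq = clash (trans (cong (L w₀) eq) w₀y) (L-sym uw₀) λ ()
      uy : L u y ≡ none
      uy with L u y in eq
      ... | none = refl
      ... | neg  = ⊥-elim (proj₂ (third uw₀) (L-sym eq))
      ... | pos  = ⊥-elim (clash (P-pos (L-sym eq) (L-sym w₀y) λ eq → clash uw₀ (trans (cong (L u) (sym eq)) (irreflexive u)) λ ()) uw₀ λ ())
      near : ∀ {w} → L u w ≡ neg → L w y ≡ pos
      near {w} uw with w ≟ w₀
      ... | yes refl = w₀y
      ... | no w≢w₀  = P-pos (N-pos uw₀ uw (w≢w₀ ∘ sym)) w₀y λ eq → clash uw (trans (cong (L u) eq) uy) λ ()
    c≡-6 : c ≡ - + 6
    c≡-6 = let y , (v≢y , vy) , near = antipode-spec v₀ in begin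
      c ≡⟨ sym (A²-non v₀ y v≢y vy) ⟩
      A² L v₀ y ≡⟨ sym (walks-profile v₀ y) ⟩
      walks (profile v₀ y) ≡⟨ cong walks (saturated⁻ (profile v₀ y) (balanced v₀ y)
                                (near (L-N v₀ _)) (near (L-N v₀ _)) (near (L-N v₀ _))) ⟩
      - + 6 ∎
      where open ≡-Reasoning
    far-profile : ∀ {x y} → Far x y → profile x y ≡ antipodal
    far-profile {x} {y} (x≢y , xy) =
      walks-minimal (profile x y) (trans (walks-profile x y) (trans (A²-non x y x≢y xy) c≡-6))
    far-P : ∀ {x y w} → Far x y → L x w ≡ pos → L w y ≡ neg
    far-P far xw with P-complete xw
    ... | zero , refl             = cong Profile.p₀ (far-profile far)
    ... | suc zero , refl         = cong Profile.p₁ (far-profile far)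
    ... | suc (suc zero) , refl   = cong Profile.p₂ (far-profile far)
    far-N : ∀ {x y w} → Far x y → L x w ≡ neg → L w y ≡ pos
    far-N far xw with N-complete xw
    ... | zero , refl             = cong Profile.n₀ (far-profile far)
    ... | suc zero , refl         = cong Profile.n₁ (far-profile far)
    ... | suc (suc zero) , refl   = cong Profile.n₂ (far-profile far)
    -- Distinct y and z would both be positive neighbours of `N x zero`, so yz would be positive;
    -- then `far-P` at y makes zx negative.
    far-unique : ∀ {x y z} → Far x y → Far x z → y ≡ z
    far-unique {x} {y} {z} xy xz with y ≟ z
    ... | yes y≡z = y≡z
    ... | no  y≢z = ⊥-elim (clash (far-P (≢-sym (proj₁ xy) , L-sym (proj₂ xy))
      (P-pos (far-N xy (L-N x zero)) (far-N xz (L-N x zero)) y≢z))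
      (L-sym (proj₂ xz)) λ ())
    -- Equality is included, since the diagonal labels are `none`.
    S : Fin n → Fin n → Set
    S x y = L x y ≡ none
    S-trans : ∀ {x y z} → S x y → S y z → S x z
    S-trans {x} {y} {z} xy yz with x ≟ y | y ≟ z
    ... | yes refl | _        = yz
    ... | no _     | yes refl = xy
    ... | no x≢y   | no y≢z   =
      trans (cong (L x) (sym (far-unique (≢-sym x≢y , L-sym xy) (y≢z , yz)))) (irreflexive x)
    meet : ∀ {x y} → R x y → S x y → x ≡ y
    meet (inj₁ eq) _  = eq
    meet (inj₂ xy) xy′ = ⊥-elim (clash xy xy′ λ ())
    RS⇒SR : ∀ {x y z} → R x y → S y z → ∃ λ w → S x w × R w z
    RS⇒SR (inj₁ refl) yz = _ , yz , inj₁ refl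
    RS⇒SR {x} {y} {z} (inj₂ xy) yz with y ≟ z
    ... | yes refl = x , irreflexive x , inj₂ xy
    -- By `far-P` the edge xz is negative, and the antipode of x is positively joined to all of
    -- N(x).
    ... | no  y≢z  = let w , (_ , xw) , near = antipode-spec x
                     in w , xw , inj₂ (L-sym (near (far-P (y≢z , yz) (L-sym xy))))
    edge : ∀ {x y} → L x y ≢ none → ∃ λ w → S x w × R w y
    edge {x} {y} xy with L x y in eq
    ... | none = contradiction refl xy
    ... | pos  = x , irreflexive x , inj₂ eq
    ... | neg  = let w , (_ , xw) , near = antipode-spec x in w , xw , inj₂ (L-sym (near eq))
    v̄₀ = proj₁ (antipode-spec v₀)
    v₀-far : Far v₀ v̄₀
    v₀-far = proj₁ (proj₂ (antipode-spec v₀))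
    S-class : Class S v₀ 2
    S-class = record
      { member    = member
      ; related   = λ { zero → irreflexive v₀ ; (suc zero) → proj₂ v₀-far }
      ; injective = λ { {zero} {zero} _ → refl ; {zero} {suc zero} eq → contradiction eq (proj₁ v₀-far)
                      ; {suc zero} {zero} eq → contradiction (sym eq) (proj₁ v₀-far) ; {suc zero} {suc zero} _ → refl }
      ; complete  = complete }
      where
      member : Fin 2 → Fin n
      member zero       = v₀
      member (suc zero) = v̄₀
      complete : ∀ {x} → S v₀ x → ∃ λ i → member i ≡ x
      complete {x} v₀x with v₀ ≟ x
      ... | yes v₀≡x = zero , v₀≡x
      ... | no  v₀≢x = suc zero , far-unique v₀-far (v₀≢x , v₀x)
    R-equiv : IsEquivalence R
    R-equiv = closed-equivalence P-pos
    S-equiv : IsEquivalence S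
    S-equiv = record { refl = irreflexive _ ; sym = L-sym ; trans = S-trans }
    open Grid L connected R-equiv S-equiv meet RS⇒SR edge v₀ R-class S-class
    label : Bool → Bool → Label
    label same-row same-column = if same-column then none else (if same-row then pos else neg)
    by-coordinates : ∀ x y → label (does (row x ≟ row y)) (does (column x ≟ column y)) ≡ L x y
    by-coordinates x y with row x ≟ row y | column x ≟ column y
    ... | _     | yes s = sym (column⇒S s)
    ... | yes r | no ¬s = [ (λ x≡y → contradiction (cong column x≡y) ¬s) , sym ]′ (row⇒R r)
    ... | no ¬r | no ¬s with L x y in eq
    ... | none = contradiction (S⇒column eq) ¬s
    ... | pos  = contradiction (R⇒row (inj₂ eq)) ¬r
    ... | neg  = refl
    labels : ∀ x y → S48-lab (row x , column x) (row y , column y) ≡ L x y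
    labels = by-coordinates

  classify : (a , b , X , Y) ∈ spectrum → (L ≅ S48 ⊎ L ≅ S16) ⊎ (a ≡ - + 4 × b ≡ + 4)
  classify h with outcome h
  ... | sparse X≢ Y≢ m eq m∣12    = ⊥-elim (too-few-walks X≢ Y≢ eq m∣12)
  ... | cliques X≡pos Y≡pos       = inj₁ (inj₁ (cliques-S48 X≡pos Y≡pos))
  ... | negated a≡ b≡             = inj₂ (a≡ , b≡)
  ... | grid X≡pos Y≡neg          = inj₁ (inj₂ (grid-S16 X≡pos Y≡neg))
  ... | closing⁻ Y≡pos X≢pos      = contradiction (Y≡pos⇒X≡pos Y≡pos) X≢pos
  ... | closing⁺ X≡neg Y≢neg      = contradiction (X≡neg⇒Y≡neg X≡neg) Y≢neg

-- Degrees, negation and the classification up to negation.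

Target : (Fin n → Fin n → Label) → Set
Target L = Connected L × Regular 6 L × IsSRSG L × NetRegular (+ 0) L

degree-split : (L : Fin n → Fin n → Label) → ∀ v → degree L v ≡ d⁺ L v ℕ.+ d⁻ L v
degree-split L v = ℤ.+-injective (begin
  + degree L v ≡⟨ count-𝟙 (isEdge ∘ L v) ⟩
  Σℤ (λ u → 𝟙 (isEdge (L v u))) ≡⟨ Σ-cong (λ u → edge-split (L v u)) ⟩
  Σℤ (λ u → 𝟙⁺ (L v u) + 𝟙⁻ (L v u)) ≡⟨ Σ-+ (λ u → 𝟙⁺ (L v u)) _ ⟩
  Σℤ (λ u → 𝟙⁺ (L v u)) + Σℤ (λ u → 𝟙⁻ (L v u))
    ≡⟨ cong₂ _+_ (sym (count-𝟙 (isPos ∘ L v))) (sym (count-𝟙 (isNeg ∘ L v))) ⟩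
  + d⁺ L v + + d⁻ L v ≡⟨ sym (ℤ.pos-+ (d⁺ L v) (d⁻ L v)) ⟩
  + (d⁺ L v ℕ.+ d⁻ L v) ∎)
  where
  open ≡-Reasoning
  edge-split : ∀ l → 𝟙 (isEdge l) ≡ 𝟙⁺ l + 𝟙⁻ l
  edge-split none = refl
  edge-split pos  = refl
  edge-split neg  = refl

signed-degrees : (L : Fin n → Fin n → Label) → Regular 6 L → NetRegular (+ 0) L →
  ∀ v → d⁺ L v ≡ 3 × d⁻ L v ≡ 3
signed-degrees L regular net v = d⁺≡3 , trans (sym d⁺≡d⁻) d⁺≡3
  where
  d⁺≡d⁻ : d⁺ L v ≡ d⁻ L v
  d⁺≡d⁻ = ℤ.+-injective (ℤ.i-j≡0⇒i≡j _ _ (net v))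
  double : ∀ k → k ℕ.+ k ≡ 2 ℕ.* k
  double k = cong (k ℕ.+_) (sym (ℕ.+-identityʳ k))
  d⁺≡3 : d⁺ L v ≡ 3
  d⁺≡3 = ℕ.*-cancelˡ-≡ _ _ 2 (trans (sym (double (d⁺ L v)))
    (trans (cong (d⁺ L v ℕ.+_) d⁺≡d⁻) (trans (sym (degree-split L v)) (regular v))))

negLabel-involutive : ∀ l → negLabel (negLabel l) ≡ l
negLabel-involutive none = refl
negLabel-involutive pos  = refl
negLabel-involutive neg  = refl

negLabel⁻¹ : ∀ {l k} → negLabel l ≡ k → l ≡ negLabel k
negLabel⁻¹ {l} eq = trans (sym (negLabel-involutive l)) (cong negLabel eq)

negate-signed : {L : Fin n → Fin n → Label} → IsSignedGraph L → IsSignedGraph (negate L)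
negate-signed sg = record
  { symmetric   = λ u v → cong negLabel (symmetric u v)
  ; irreflexive = λ u → cong negLabel (irreflexive u) }
  where open IsSignedGraph sg

negate-walk : {L : Fin n → Fin n → Label} → ∀ {u v} → Walk L u v → Walk (negate L) u v
negate-walk here       = here
negate-walk (step e p) = step (e ∘ negLabel⁻¹) (negate-walk p)

count-cong : {χ ψ : Fin n → Bool} → (∀ i → χ i ≡ ψ i) → count χ ≡ count ψ
count-cong {χ = χ} {ψ} h =
  ℤ.+-injective (trans (count-𝟙 χ) (trans (Σ-cong λ i → cong 𝟙 (h i)) (sym (count-𝟙 ψ))))

negate-d⁺ : (L : Fin n → Fin n → Label) → ∀ v → d⁺ (negate L) v ≡ d⁻ L v
negate-d⁺ L v = count-cong λ u → swap (L v u)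
  where
  swap : ∀ l → isPos (negLabel l) ≡ isNeg l
  swap none = refl
  swap pos  = refl
  swap neg  = refl

negate-d⁻ : (L : Fin n → Fin n → Label) → ∀ v → d⁻ (negate L) v ≡ d⁺ L v
negate-d⁻ L v = count-cong λ u → swap (L v u)
  where
  swap : ∀ l → isNeg (negLabel l) ≡ isPos l
  swap none = refl
  swap pos  = refl
  swap neg  = refl

negate-regular : ∀ {r} {L : Fin n → Fin n → Label} → Regular r L → Regular r (negate L)
negate-regular {L = L} regular v = trans (count-cong λ u → same (L v u)) (regular v)
  where
  same : ∀ l → isEdge (negLabel l) ≡ isEdge l
  same none = refl
  same pos  = refl
  same neg  = refl

negate-net : {L : Fin n → Fin n → Label} → NetRegular (+ 0) L → NetRegular (+ 0) (negate L)
negate-net {L = L} net v = begin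
  + d⁺ (negate L) v - + d⁻ (negate L) v ≡⟨ cong₂ (λ x y → + x - + y) (negate-d⁺ L v) (negate-d⁻ L v) ⟩
  + d⁻ L v - + d⁺ L v ≡⟨ ℤ.i≡j⇒i-j≡0 (sym (ℤ.i-j≡0⇒i≡j (+ d⁺ L v) (+ d⁻ L v) (net v))) ⟩
  + 0 ∎
  where open ≡-Reasoning

negate-A² : (L : Fin n → Fin n → Label) → ∀ i j → A² (negate L) i j ≡ A² L i j
negate-A² L i j = Σ-cong λ k →
  trans (cong₂ _*_ (adj-neg (L i k)) (adj-neg (L k j))) (neg-neg (A L i k) (A L k j))
  where
  adj-neg : ∀ l → adjEntry (negLabel l) ≡ - adjEntry l
  adj-neg none = refl
  adj-neg pos  = refl
  adj-neg neg  = refl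
  neg-neg : ∀ x y → - x * - y ≡ x * y
  neg-neg = solve-∀

-- A² is unchanged while positive and negative pairs trade places, hence the exchange of a and b.
negate-SRSG : ∀ {L : Fin n → Fin n → Label} {r a b c} → IsSRSGWith L r a b c → IsSRSGWith (negate L) r b a c
negate-SRSG {L = L} (¬hc , ¬e , diag , A²-pos , A²-neg , A²-non) =
  (λ (h , complete) → ¬hc (homogeneous h , λ u v u≢v eq → complete u v u≢v (cong negLabel eq))) ,
  (λ edgeless → ¬e λ u v → negLabel⁻¹ (edgeless u v)) ,
  (λ i j eq → trans (negate-A² L i j) (diag i j eq)) ,
  (λ i j eq → trans (negate-A² L i j) (A²-neg i j (negLabel⁻¹ eq))) ,
  (λ i j eq → trans (negate-A² L i j) (A²-pos i j (negLabel⁻¹ eq))) ,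
  (λ i j ne eq → trans (negate-A² L i j) (A²-non i j ne (negLabel⁻¹ eq)))
  where
  homogeneous : Homogeneous (negate L) → Homogeneous L
  homogeneous (inj₁ no-neg) = inj₂ λ u v eq → no-neg u v (cong negLabel eq)
  homogeneous (inj₂ no-pos) = inj₁ λ u v eq → no-pos u v (cong negLabel eq)

negate-Target : {L : Fin n → Fin n → Label} → Target L → Target (negate L)
negate-Target (connected , regular , (r , a , b , c , srsg) , net) =
  (λ u v → negate-walk (connected u v)) , negate-regular regular , (r , b , a , c , negate-SRSG srsg) , negate-net net

negate-≅ : (L : Fin n → Fin n → Label) (M : Fin m → Fin m → Label) → negate L ≅ M → L ≅ negate M
negate-≅ L M (f , eq) = f , λ u v → sym (negLabel⁻¹ (sym (eq u v)))

classification : {L : Fin n → Fin n → Label} → IsSignedGraph L → Connected L → Regular 6 L → NetRegular (+ 0) L →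
  ∀ {r a b c} → IsSRSGWith L r a b c → (L ≅ S48 ⊎ L ≅ S16) ⊎ (a ≡ - + 4 × b ≡ + 4)
-- A graph without vertices is edgeless; otherwise `zero` serves as the base vertex v₀.
classification {zero}  _ _ _ _ (_ , ¬e , _) = ⊥-elim (¬e λ ())
classification {suc n} {L} sg connected regular net {a = a} {b} {c} (_ , _ , _ , A²-pos , A²-neg , A²-non) =
  let X , Y , h , ℓ = Classify.uniform L sg connected deg⁺ deg⁻ a b c A²-pos A²-neg A²-non zero
  in Uniform.classify L sg connected deg⁺ deg⁻ a b c A²-pos A²-neg A²-non zero X Y ℓ h
  where
  deg⁺ : ∀ v → d⁺ L v ≡ 3
  deg⁺ v = proj₁ (signed-degrees L regular net v)
  deg⁻ : ∀ v → d⁻ L v ≡ 3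
  deg⁻ v = proj₂ (signed-degrees L regular net v)

-- Transport along isomorphisms.

Σℤ≡sum : (f : Fin n → ℤ) → Σℤ f ≡ sum f
Σℤ≡sum {zero}  f = refl
Σℤ≡sum {suc n} f = cong (λ s → f zero + s) (Σℤ≡sum (f ∘ suc))

Σ-permute : (π : Fin n ↔ Fin m) (f : Fin m → ℤ) → Σℤ (f ∘ Inverse.to π) ≡ Σℤ f
Σ-permute π f = trans (Σℤ≡sum (f ∘ Inverse.to π)) (trans (sym (sum-permute f π)) (sym (Σℤ≡sum f)))

module Transport (L : Fin n → Fin n → Label) (M : Fin m → Fin m → Label) (iso : L ≅ M) where

  open Inverse (proj₁ iso)

  M≡L : ∀ u v → M (to u) (to v) ≡ L u v
  M≡L = proj₂ iso

  L≡M : ∀ x y → L (from x) (from y) ≡ M x y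
  L≡M x y = trans (sym (M≡L (from x) (from y))) (cong₂ M (inverseˡ refl) (inverseˡ refl))

  from-injective : ∀ {x y} → from x ≡ from y → x ≡ y
  from-injective eq = trans (sym (inverseˡ refl)) (trans (cong to eq) (inverseˡ refl))

  to-injective : ∀ {u v} → to u ≡ to v → u ≡ v
  to-injective eq = trans (sym (inverseʳ refl)) (trans (cong from eq) (inverseʳ refl))

  count-transport : (χ : Label → Bool) → ∀ v → count (χ ∘ L v) ≡ count (χ ∘ M (to v))
  count-transport χ v = ℤ.+-injective (begin
    + count (χ ∘ L v) ≡⟨ count-𝟙 (χ ∘ L v) ⟩
    Σℤ (λ u → 𝟙 (χ (L v u))) ≡⟨ Σ-cong (λ u → cong (𝟙 ∘ χ) (sym (M≡L v u))) ⟩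
    Σℤ (λ u → 𝟙 (χ (M (to v) (to u)))) ≡⟨ Σ-permute (proj₁ iso) (λ x → 𝟙 (χ (M (to v) x))) ⟩
    Σℤ (λ x → 𝟙 (χ (M (to v) x))) ≡⟨ sym (count-𝟙 (χ ∘ M (to v))) ⟩
    + count (χ ∘ M (to v)) ∎)
    where open ≡-Reasoning

  A²-transport : ∀ u v → A² L u v ≡ A² M (to u) (to v)
  A²-transport u v = trans
    (Σ-cong λ k → cong₂ (λ x y → adjEntry x * adjEntry y) (sym (M≡L u k)) (sym (M≡L k v)))
    (Σ-permute (proj₁ iso) (λ x → A M (to u) x * A M x (to v)))

  walk : ∀ {x y} → Walk M x y → Walk L (from x) (from y)
  walk here               = here
  walk (step {x} {y} e p) = step (e ∘ trans (sym (L≡M x y))) (walk p)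

  target : Target M → Target L
  target (connected , regular , (r , a , b , c , ¬hc , ¬e , diag , A²-pos , A²-neg , A²-non) , net) =
    (λ u v → subst₂ (Walk L) (inverseʳ refl) (inverseʳ refl) (walk (connected (to u) (to v)))) ,
    (λ v → trans (count-transport isEdge v) (regular (to v))) ,
    (r , a , b , c ,
      (λ (h , complete) → ¬hc (Sum.map (λ no-neg x y → no-neg _ _ ∘ trans (L≡M x y)) (λ no-pos x y → no-pos _ _ ∘ trans (L≡M x y)) h ,
        λ x y x≢y eq → complete _ _ (x≢y ∘ from-injective) (trans (L≡M x y) eq))) ,
      (λ edgeless → ¬e λ x y → trans (sym (L≡M x y)) (edgeless _ _)) ,
      (λ i j eq → trans (A²-transport i j) (diag _ _ (cong to eq))) ,
      (λ i j eq → trans (A²-transport i j) (A²-pos _ _ (trans (M≡L i j) eq))) ,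
      (λ i j eq → trans (A²-transport i j) (A²-neg _ _ (trans (M≡L i j) eq))) ,
      (λ i j ne eq → trans (A²-transport i j) (A²-non _ _ (ne ∘ to-injective) (trans (M≡L i j) eq)))) ,
    (λ v → trans (cong₂ (λ x y → + x - + y) (count-transport isPos v) (count-transport isNeg v)) (net (to v)))

-- Verification of the two graphs and both directions of the classification.

-- In both graphs any two vertices, equal or not, have a common neighbour, which a finite check
-- decides.
connected-by-2-walks : {M : Fin m → Fin m → Label} →
  (∀ u v → ∃ λ w → M u w ≢ none × M w v ≢ none) → Connected M
connected-by-2-walks h u v = let w , uw , wv = h u v in step uw (step wv here)

module Check (M : Fin m → Fin m → Label) where

  connected? : Dec (∀ u v → ∃ λ w → M u w ≢ none × M w v ≢ none)
  connected? = all? λ u → all? λ v → any? λ w → ¬? (M u w ≟ˡ none) ×-dec ¬? (M w v ≟ˡ none)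

  regular? : Dec (Regular 6 M)
  regular? = all? λ v → degree M v ℕ.≟ 6

  net? : Dec (NetRegular (+ 0) M)
  net? = all? λ v → netDegree M v ℤ.≟ + 0

  entries? : ∀ a b c → Dec (
    (∀ i j → i ≡ j → A² M i j ≡ + 6) × (∀ i j → M i j ≡ pos → A² M i j ≡ a) ×
    (∀ i j → M i j ≡ neg → A² M i j ≡ b) × (∀ i j → i ≢ j → M i j ≡ none → A² M i j ≡ c))
  entries? a b c =
    (all? λ i → all? λ j → i ≟ j →-dec A² M i j ℤ.≟ + 6) ×-dec
    (all? λ i → all? λ j → M i j ≟ˡ pos →-dec A² M i j ℤ.≟ a) ×-dec
    (all? λ i → all? λ j → M i j ≟ˡ neg →-dec A² M i j ℤ.≟ b) ×-dec
    (all? λ i → all? λ j → ¬? (i ≟ j) →-dec M i j ≟ˡ none →-dec A² M i j ℤ.≟ c)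

S48-Target : Target S48
S48-Target =
  connected-by-2-walks (toWitness {a? = connected?} _) ,
  toWitness {a? = regular?} _ ,
  (6 , + 4 , - + 4 , - + 6 ,
    -- The negative edge x₁y₂ and the positive edge x₁x₂.
    (λ { (inj₁ no-neg , _) → no-neg (# 0) (# 5) refl ; (inj₂ no-pos , _) → no-pos (# 0) (# 1) refl }) ,
    (λ edgeless → contradiction (edgeless (# 0) (# 1)) λ ()) ,
    toWitness {a? = entries? (+ 4) (- + 4) (- + 6)} _) ,
  toWitness {a? = net?} _
  where open Check S48

S16-Target : Target S16
S16-Target =
  connected-by-2-walks (toWitness {a? = connected?} _) ,
  toWitness {a? = regular?} _ ,
  (6 , + 2 , + 2 , - + 2 ,
    -- The negative edge from (1, 1) to (2, 1) and the positive edge from (1, 1) to (1, 2).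
    (λ { (inj₁ no-neg , _) → no-neg (# 0) (# 4) refl ; (inj₂ no-pos , _) → no-pos (# 0) (# 1) refl }) ,
    (λ edgeless → contradiction (edgeless (# 0) (# 1)) λ ()) ,
    toWitness {a? = entries? (+ 2) (+ 2) (- + 2)} _) ,
  toWitness {a? = net?} _
  where open Check S16

theorem3p32 : (n : ℕ) (L : Fin n → Fin n → Label) → IsSignedGraph L →
    (Connected L × Regular 6 L × IsSRSG L × NetRegular (+ 0) L)
    ⇔ (L ≅ S48 ⊎ L ≅ negate S48 ⊎ L ≅ S16 ⊎ L ≅ negate S16)
theorem3p32 n L sg = mk⇔ forward backward
  where
  forward : Target L → L ≅ S48 ⊎ L ≅ negate S48 ⊎ L ≅ S16 ⊎ L ≅ negate S16
  forward (connected , regular , (r , a , b , c , srsg) , net) with classification sg connected regular net srsg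
  ... | inj₁ (inj₁ L≅S48) = inj₁ L≅S48
  ... | inj₁ (inj₂ L≅S16) = inj₂ (inj₂ (inj₁ L≅S16))
  ... | inj₂ (refl , refl)
    with classification (negate-signed sg) (λ u v → negate-walk (connected u v)) (negate-regular regular)
           (negate-net net) (negate-SRSG srsg)
  -- The negation has a = 4 and b = -4, so its remaining alternative, a = -4 and b = 4, is absurd.
  ... | inj₁ (inj₁ -L≅S48) = inj₂ (inj₁ (negate-≅ L S48 -L≅S48))
  ... | inj₁ (inj₂ -L≅S16) = inj₂ (inj₂ (inj₂ (negate-≅ L S16 -L≅S16)))
  backward : L ≅ S48 ⊎ L ≅ negate S48 ⊎ L ≅ S16 ⊎ L ≅ negate S16 → Target L
  backward (inj₁ iso)                = Transport.target L S48 iso S48-Target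
  backward (inj₂ (inj₁ iso))         = Transport.target L (negate S48) iso (negate-Target S48-Target)
  backward (inj₂ (inj₂ (inj₁ iso)))  = Transport.target L S16 iso S16-Target
  backward (inj₂ (inj₂ (inj₂ iso)))  = Transport.target L (negate S16) iso (negate-Target S16-Target)
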